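{- Let $n\ge 1$ be an integer, let $J\subseteq\mathbb{R}$ be an open interval, and let $f,g:J\to\mathbb{R}$ be functions having at least $n$ derivatives on $J$, with $f'(t)\neq 0$ for all $t\in J$. Let $x=f(t)$ and $y=g(t)$, so that $y$ is given parametrically as a function of $x$. Then for every $t\in J$, the $n$-th derivative of $y$ with respect to $x$ at the point with parameter $t$ is \[ \frac{d^ny}{dx^n}=\sum_{k=0}^{n-1}(-1)^k\left[f'(t)\right]^{ -n-k}\,\boldsymbol{P}_{n,k}(t). \]
   Context: Since $f'$ does not vanish on the interval $J$, $f$ is injective, and $y$ as a function of $x$ is $g\circ f^{ -1}$ on $f(J)$. The expression $\frac{d^ny}{dx^n}$ at parameter $t$ means $(g\circ f^{ -1})^{(n)}(f(t))$; equivalently, it is obtained from $g$ by applying $n$ times the operation "take $d/dt$ and divide by $f'(t)$". Definition of $\boldsymbol{P}_{n,k}(t)$: for integers $n\ge1$ and $k\ge 0$, let $\Pi_{n,k}$ be the set of all set partitions $\pi$ of $\{1,2,\dots,k+n\}$ into exactly $k+1$ (nonempty) blocks such that every block not containing $1$ has at least two elements (only the block containing $1$ may be a singleton). For $\pi\in\Pi_{n,k}$ let $B_1(\pi)$ denote the block containing $1$. Then \[ \boldsymbol{P}_{n,k}(t)=\sum_{\pi\in\Pi_{n,k}} g^{(|B_1(\pi)|)}(t)\prod_{B\in\pi,\ B\ne B_1(\pi)} f^{(|B|)}(t), \] where $h^{(m)}$ is the $m$-th derivative of $h$. An empty sum is $0$ and an empty product is $1$. -}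

module Defs where

open import Level using (0ℓ) renaming (suc to lsuc)
open import Algebra.Bundles using (CommutativeRing)
open import Data.Bool.Base using (if_then_else_)
open import Data.List.Base
  using (List; []; _∷_; _++_; map; filter; foldr; concat; length; applyUpTo)
open import Data.List.Membership.DecPropositional as Membership using ()
open import Data.List.Relation.Unary.All using (All; all?)
open import Data.Nat.Base as ℕ using (ℕ; suc)
import Data.Nat.Properties as ℕ
open import Data.Product.Base using (Σ; ∃; _×_; _,_; proj₁)
open import Function.Base using (_∘′_)
open import Function.Bundles using (Func)
import Function.Construct.Composition as Composition
open import Function.Definitions using (Injective)
open import Relation.Binary.Bundles using (Setoid)
open import Relation.Binary.Core using (Rel)
import Relation.Binary.Construct.Add.Extrema.Strict as AddExtrema
import Relation.Binary.Construct.On as On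
import Relation.Binary.Construct.StrictToNonStrict as StrictToNonStrict
open import Relation.Binary.PropositionalEquality.Core using (_≡_)
open import Relation.Binary.Structures using (IsStrictTotalOrder)
open import Relation.Nullary.Construct.Add.Extrema using (_±; [_])
open import Relation.Nullary.Decidable using (does; ¬?; _×-dec_; _→-dec_)
open import Relation.Nullary.Negation.Core using (¬_)
open import Relation.Unary using (Pred; Satisfiable; Decidable)

-- A Dedekind-complete ordered field. Classically such a field exists and is
-- unique up to isomorphism, so quantifying over these records is quantifying
-- over presentations of ℝ. Equality is a setoid equality, so that Dedekind
-- cuts (ℚ → Bool) are an instance under excluded middle without quotients or
-- function extensionality.

record CompleteOrderedField : Set (lsuc 0ℓ) where
  field
    commutativeRing : CommutativeRing 0ℓ 0ℓ

  open CommutativeRing commutativeRing public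

  infix 4 _<_

  field
    0≉1                : 0# ≉ 1#
    inv                : (x : Carrier) → x ≉ 0# → Carrier
    *-invʳ             : ∀ x (x≉0 : x ≉ 0#) → x * inv x x≉0 ≈ 1#
    _<_                : Rel Carrier 0ℓ
    isStrictTotalOrder : IsStrictTotalOrder _≈_ _<_
    +-monoʳ-<          : ∀ x {y z} → y < z → x + y < x + z
    *-pos              : ∀ {x y} → 0# < x → 0# < y → 0# < x * y

  open StrictToNonStrict _≈_ _<_ public using (_≤_)

  UpperBound : Pred Carrier 0ℓ → Carrier → Set
  UpperBound P u = ∀ x → P x → x ≤ u

  field
    complete : (P : Pred Carrier 0ℓ) → Satisfiable P → ∃ (UpperBound P) →
               ∃ λ s → UpperBound P s × (∀ u → UpperBound P u → s ≤ u)

-- The sublists of a list. If the list has no repeated entries, these are its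
-- subsets, each listed exactly once.

subsets : {A : Set} → List A → List (List A)
subsets []       = [] ∷ []
subsets (x ∷ xs) = subsets xs ++ map (x ∷_) (subsets xs)

[1‥_] : ℕ → List ℕ
[1‥ m ] = applyUpTo suc m

Block : Set
Block = List ℕ

open Membership ℕ._≟_ using (_∈_; _∈?_)

-- For a family π of subsets of {1,…,m}: all members are nonempty, and every
-- element lies in exactly one of them.

IsSetPartition : ℕ → Pred (List Block) 0ℓ
IsSetPartition m π =
  All (λ B → 1 ℕ.≤ length B) π ×
  All (λ i → length (filter (i ∈?_) π) ≡ 1) [1‥ m ]

InΠ : ℕ → ℕ → Pred (List Block) 0ℓ
InΠ n k π =
  IsSetPartition (k ℕ.+ n) π ×
  length π ≡ suc k ×
  All (λ B → ¬ (1 ∈ B) → 2 ℕ.≤ length B) π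

InΠ? : ∀ n k → Decidable (InΠ n k)
InΠ? n k π =
  (all? (λ B → 1 ℕ.≤? length B) π ×-dec
   all? (λ i → length (filter (i ∈?_) π) ℕ.≟ 1) [1‥ k ℕ.+ n ]) ×-dec
  (length π ℕ.≟ suc k) ×-dec
  all? (λ B → ¬? (1 ∈? B) →-dec (2 ℕ.≤? length B)) π

Π : ℕ → ℕ → List (List Block)
Π n k = filter (InΠ? n k) (subsets (subsets [1‥ k ℕ.+ n ]))

-- In a set partition the filtered list has a single member, so its
-- concatenation is the block containing 1.

B₁ : List Block → Block
B₁ π = concat (filter (1 ∈?_) π)

otherBlocks : List Block → List Block
otherBlocks π = filter (λ B → ¬? (1 ∈? B)) π

module Calculus (ℝ : CompleteOrderedField) where

  open CompleteOrderedField ℝ public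
  open import Algebra.Properties.Semiring.Exp semiring public using (_^_)
  open import Algebra.Properties.Monoid.Sum +-monoid public
    using (sum; sum-syntax)
  open AddExtrema _<_ using (_<±_)

  ∣_∣ : Carrier → Carrier
  ∣ x ∣ = if does (x <? 0#) then - x else x
    where open IsStrictTotalOrder isStrictTotalOrder using (_<?_)

  Subset : Set₁
  Subset = Pred Carrier 0ℓ

  -- The endpoints may be infinite.

  OpenInterval : (a b : Carrier ±) → Subset
  OpenInterval a b t = a <± [ t ] × [ t ] <± b

  Point : Subset → Set
  Point S = Σ Carrier S

  subsetoid : Subset → Setoid 0ℓ 0ℓ
  subsetoid S = On.setoid {B = Point S} setoid proj₁

  Fun : Subset → Set
  Fun S = Func (subsetoid S) setoid

  open Func public using () renaming (to to infixl 20 _⟨$⟩_)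

  HasDerivativeAt : ∀ {S} → Fun S → Point S → Carrier → Set
  HasDerivativeAt {S} h a L =
    ∀ ε → 0# < ε → ∃ λ δ → 0# < δ ×
      ((x : Point S) (x-a≉0 : proj₁ x - proj₁ a ≉ 0#) →
       ∣ proj₁ x - proj₁ a ∣ < δ →
       ∣ (h ⟨$⟩ x - h ⟨$⟩ a) * inv (proj₁ x - proj₁ a) x-a≉0 - L ∣ < ε)

  IsDerivative : ∀ {S} → Fun S → Fun S → Set
  IsDerivative h h′ = ∀ a → HasDerivativeAt h a (h′ ⟨$⟩ a)

  -- The derivatives of h of order at most N. The terms of `deriv` of order
  -- greater than N are unconstrained.

  record Derivatives {S} (N : ℕ) (h : Fun S) : Set where
    field
      deriv      : ℕ → Fun S
      deriv-zero : ∀ t → deriv 0 ⟨$⟩ t ≈ h ⟨$⟩ t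
      deriv-suc  : ∀ {m} → m ℕ.< N → IsDerivative (deriv m) (deriv (suc m))

  infix 21 _⁽_⁾

  _⁽_⁾ : ∀ {S N} {h : Fun S} → Derivatives N h → ℕ → Fun S
  H ⁽ m ⁾ = Derivatives.deriv H m

  IsInjective : ∀ {S} → Fun S → Set
  IsInjective {S} f = Injective (Setoid._≈_ (subsetoid S)) _≈_ (f ⟨$⟩_)

  Image : ∀ {S} → Fun S → Subset
  Image {S} f x = ∃ λ (t : Point S) → f ⟨$⟩ t ≈ x

  image : ∀ {S} (f : Fun S) → Point S → Point (Image f)
  image f t = f ⟨$⟩ t , t , refl

  inverse : ∀ {S} (f : Fun S) → IsInjective f →
            Func (subsetoid (Image f)) (subsetoid S)
  inverse f inj = record
    { to   = λ (_ , t , _) → t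
    ; cong = λ { {_ , _ , ft≈x} {_ , _ , fu≈y} x≈y →
                 inj (trans ft≈x (trans x≈y (sym fu≈y))) }
    }

  _∘_⁻¹[_] : ∀ {S} → Fun S → (f : Fun S) → IsInjective f → Fun (Image f)
  g ∘ f ⁻¹[ inj ] = Composition.function (inverse f inj) g

  ∑ ∏ : {A : Set} → (A → Carrier) → List A → Carrier
  ∑ w = foldr _+_ 0# ∘′ map w
  ∏ w = foldr _*_ 1# ∘′ map w

  -- For k < n, the blocks of a member of Π n k have at most n elements, so
  -- only derivatives of order at most n enter.

  P : ∀ {S N} {f g : Fun S} (n k : ℕ) →
      Derivatives N f → Derivatives N g → Point S → Carrier
  P n k F G t =
    ∑ (λ π → G ⁽ length (B₁ π) ⁾ ⟨$⟩ t *
             ∏ (λ B → F ⁽ length B ⁾ ⟨$⟩ t) (otherBlocks π))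
      (Π n k)

{-# OPTIONS --safe #-}
module Submission where

-- With D = (1/f′) d/dt, the product rule turns the asserted formula for n
-- into the one for n + 1 precisely if
--   P (n+1) k = (P n k)′ + (n + k - 1) f″ P n (k-1).
-- Combinatorially: removing the largest element from a partition in
-- Π (n+1) k either shrinks a block to one that is still admissible, and
-- putting the element back into an arbitrary block is the product rule, or
-- destroys a pair {i , n+k+1}, where i is one of the n + k - 1 elements other
-- than 1, and leaves a partition counted by Π n (k-1). The recurrence is
-- verified on sums that depend only on the sizes of blocks, obtained from the
-- sum over Π by repeatedly splitting off the block of the first element.
--
-- On the analytic side, a differentiable function on an interval whose
-- derivative has no zero attains no interior maximum or minimum on any
-- subinterval, so by the extreme value theorem its value at y lies strictly
-- between those at x and z whenever x < y < z. This yields injectivity and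
-- continuity of the inverse, and the derivative of g ∘ f⁻¹ then follows from
-- Carathéodory's characterisation of derivatives by continuous slopes.

open import Defs
open import Level using (0ℓ)
open import Axiom.ExcludedMiddle using (ExcludedMiddle)
open import Data.Fin.Base using (toℕ)
open import Data.Nat.Base using (ℕ) renaming (_≤_ to _≤ℕ_; _+_ to _+ℕ_)
open import Data.Product.Base using (Σ-syntax)
open import Relation.Nullary.Construct.Add.Extrema using (_±)
open import Data.Nat.Base as ℕ using (zero; suc; z≤n; s≤s)
open import Data.Product.Base using (∃; _×_; _,_; proj₁; proj₂)
open import Relation.Nullary.Construct.Add.Extrema using ([_])
open import Algebra.Bundles using (CommutativeRing)
import Algebra.Properties.Ring
import Algebra.Properties.Semiring.Exp
import Algebra.Properties.Semiring.Mult.TCOptimised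
import Algebra.Solver.Ring
open import Algebra.Solver.Ring.AlmostCommutativeRing
  using (_-Raw-AlmostCommutative⟶_; fromCommutativeRing)
open import Data.Bool.Base using (if_then_else_)
open import Data.Empty using (⊥; ⊥-elim)
import Data.Integer.Base as ℤ
import Data.Integer.Properties as ℤ
open import Data.List.Base using (List; []; _∷_; _++_; map; filter; length; concat; applyUpTo)
import Data.List.Membership.DecPropositional
import Data.List.Membership.Propositional as Membership
open import Data.List.Membership.Propositional.Properties using (∈-filter⁺; ∈-filter⁻)
import Data.List.Properties as List
open import Data.List.Relation.Unary.All as All using (All; []; _∷_; all?)
import Data.List.Relation.Unary.All.Properties as All
open import Data.List.Relation.Unary.AllPairs using ([]; _∷_)
open import Data.List.Relation.Unary.Any using (here; there)
open import Data.List.Relation.Unary.Unique.Propositional using (Unique)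
import Data.List.Relation.Unary.Unique.Propositional.Properties as Unique
open import Data.Maybe.Base using (Maybe; just; nothing)
import Data.Nat.Properties as ℕ
open import Data.Sum.Base using (_⊎_; inj₁; inj₂)
open import Function.Base using (_∘_; id)
open import Function.Bundles using (module Func)
import Relation.Binary.Construct.Add.Extrema.Strict as AddExtrema
import Relation.Binary.Construct.StrictToNonStrict as StrictToNonStrict
open import Relation.Binary.Definitions using (tri<; tri≈; tri>)
open import Relation.Binary.PropositionalEquality as ≡ using (_≡_; _≢_)
import Relation.Binary.Reasoning.Setoid
open import Relation.Binary.Structures using (IsStrictTotalOrder)
open import Relation.Nullary.Decidable using (Dec; yes; no; does; ¬?; _×-dec_; _→-dec_)
open import Relation.Nullary.Negation using (¬_; contradiction)
open import Relation.Unary using (Pred; Decidable)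

-- The library's ring solver proves cancellations only over coefficients with
-- a computing equality test, hence the integers.

-- In the step from n to n + 1, differentiating f′^(-n-k) gives -(n + k) f″ f′^(-n-k-1), and the
-- division by f′ turns the power into f′^(-(n+1)-(k+1)). This contribution therefore belongs to
-- index k + 1, and its factor n + k is the number of possible pairs in the recurrence for P (n+1)
-- (k+1); signs and powers agree term by term. The obstacle is that f and g have only n derivatives,
-- whereas the formal product rule produces derivatives of every order. Each summand that could
-- involve too high an order contains a factor that counts partitions of j elements into k blocks of
-- size at least two with j < 2k. Such a factor vanishes identically, so the summand may be
-- differentiated as the zero function. The same vanishing ends the sum over k at n - 1. Excluded
-- middle enters through the extreme value theorem, where it decides whether a higher value, or a
-- point close enough to a supremum, exists.

module IntegerSolver (R : CommutativeRing 0ℓ 0ℓ) where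

  open CommutativeRing R
  open Algebra.Properties.Ring ring
    using (-0#≈0#; -‿involutive; -‿+-comm; -‿distribˡ-*; -‿distribʳ-*)
  open Algebra.Properties.Semiring.Mult.TCOptimised semiring
    using (1+×; ×-homo-+; ×1-homo-*) renaming (_×_ to _·_)
  open Relation.Binary.Reasoning.Setoid setoid

  private
    ⟦_⟧ : ℤ.ℤ → Carrier
    ⟦ ℤ.+ n ⟧      = n · 1#
    ⟦ ℤ.-[1+ n ] ⟧ = - (ℕ.suc n · 1#)

    neg-homo : ∀ i → ⟦ ℤ.- i ⟧ ≈ - ⟦ i ⟧
    neg-homo ℤ.+0       = sym -0#≈0#
    neg-homo ℤ.+[1+ n ] = refl
    neg-homo ℤ.-[1+ n ] = sym (-‿involutive _)

    shift : ∀ x y z → (x + y) + - (x + z) ≈ y + - z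
    shift x y z = begin
      (x + y) + - (x + z)   ≈⟨ +-cong (+-comm x y) (sym (-‿+-comm x z)) ⟩
      (y + x) + (- x + - z) ≈⟨ +-assoc y x _ ⟩
      y + (x + (- x + - z)) ≈⟨ +-congˡ (+-assoc x (- x) (- z)) ⟨
      y + ((x + - x) + - z) ≈⟨ +-congˡ (+-congʳ (-‿inverseʳ x)) ⟩
      y + (0# + - z)        ≈⟨ +-congˡ (+-identityˡ _) ⟩
      y + - z               ∎

    ⊖-homo : ∀ m n → ⟦ m ℤ.⊖ n ⟧ ≈ m · 1# + - (n · 1#)
    ⊖-homo m         ℕ.zero    = begin
      m · 1#        ≈⟨ +-identityʳ _ ⟨
      m · 1# + 0#   ≈⟨ +-congˡ -0#≈0# ⟨
      m · 1# + - 0# ∎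
    ⊖-homo ℕ.zero    (ℕ.suc n) = sym (+-identityˡ _)
    ⊖-homo (ℕ.suc m) (ℕ.suc n) = begin
      ⟦ ℕ.suc m ℤ.⊖ ℕ.suc n ⟧            ≡⟨ ≡.cong ⟦_⟧ (ℤ.[1+m]⊖[1+n]≡m⊖n m n) ⟩
      ⟦ m ℤ.⊖ n ⟧                        ≈⟨ ⊖-homo m n ⟩
      m · 1# + - (n · 1#)                ≈⟨ shift 1# _ _ ⟨
      (1# + m · 1#) + - (1# + n · 1#)    ≈⟨ +-cong (1+× m 1#) (-‿cong (1+× n 1#)) ⟨
      ℕ.suc m · 1# + - (ℕ.suc n · 1#)    ∎

    +-homo : ∀ i j → ⟦ i ℤ.+ j ⟧ ≈ ⟦ i ⟧ + ⟦ j ⟧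
    +-homo (ℤ.+ m)    (ℤ.+ n)    = ×-homo-+ 1# m n
    +-homo (ℤ.+ m)    ℤ.-[1+ n ] = ⊖-homo m (ℕ.suc n)
    +-homo ℤ.-[1+ m ] (ℤ.+ n)    = trans (⊖-homo n (ℕ.suc m)) (+-comm _ _)
    +-homo ℤ.-[1+ m ] ℤ.-[1+ n ] = begin
      - (ℕ.suc (ℕ.suc (m ℕ.+ n)) · 1#)        ≡⟨ ≡.cong (λ k → - (k · 1#)) (≡.sym (ℕ.+-suc (ℕ.suc m) n)) ⟩
      - ((ℕ.suc m ℕ.+ ℕ.suc n) · 1#)          ≈⟨ -‿cong (×-homo-+ 1# (ℕ.suc m) (ℕ.suc n)) ⟩
      - (ℕ.suc m · 1# + ℕ.suc n · 1#)         ≈⟨ -‿+-comm _ _ ⟨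
      - (ℕ.suc m · 1#) + - (ℕ.suc n · 1#)     ∎

    *-homo-+ : ∀ m j → ⟦ ℤ.+ m ℤ.* j ⟧ ≈ (m · 1#) * ⟦ j ⟧
    *-homo-+ m (ℤ.+ n)    = trans (reflexive (≡.cong ⟦_⟧ (≡.sym (ℤ.pos-* m n)))) (×1-homo-* m n)
    *-homo-+ m ℤ.-[1+ n ] = begin
      ⟦ ℤ.+ m ℤ.* ℤ.-[1+ n ] ⟧         ≡⟨ ≡.cong ⟦_⟧ (ℤ.neg-distribʳ-* (ℤ.+ m) ℤ.+[1+ n ]) ⟨
      ⟦ ℤ.- (ℤ.+ m ℤ.* ℤ.+[1+ n ]) ⟧   ≈⟨ neg-homo (ℤ.+ m ℤ.* ℤ.+[1+ n ]) ⟩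
      - ⟦ ℤ.+ m ℤ.* ℤ.+[1+ n ] ⟧       ≈⟨ -‿cong (*-homo-+ m ℤ.+[1+ n ]) ⟩
      - ((m · 1#) * (ℕ.suc n · 1#))    ≈⟨ -‿distribʳ-* _ _ ⟩
      (m · 1#) * - (ℕ.suc n · 1#)      ∎

    *-homo : ∀ i j → ⟦ i ℤ.* j ⟧ ≈ ⟦ i ⟧ * ⟦ j ⟧
    *-homo (ℤ.+ m)    j = *-homo-+ m j
    *-homo ℤ.-[1+ m ] j = begin
      ⟦ ℤ.-[1+ m ] ℤ.* j ⟧         ≡⟨ ≡.cong ⟦_⟧ (ℤ.neg-distribˡ-* ℤ.+[1+ m ] j) ⟨
      ⟦ ℤ.- (ℤ.+[1+ m ] ℤ.* j) ⟧   ≈⟨ neg-homo (ℤ.+[1+ m ] ℤ.* j) ⟩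
      - ⟦ ℤ.+[1+ m ] ℤ.* j ⟧       ≈⟨ -‿cong (*-homo-+ (ℕ.suc m) j) ⟩
      - ((ℕ.suc m · 1#) * ⟦ j ⟧)   ≈⟨ -‿distribˡ-* _ _ ⟩
      - (ℕ.suc m · 1#) * ⟦ j ⟧     ∎

    morphism : ℤ.+-*-rawRing -Raw-AlmostCommutative⟶ fromCommutativeRing R
    morphism = record
      { ⟦_⟧    = ⟦_⟧
      ; +-homo = +-homo
      ; *-homo = *-homo
      ; -‿homo = neg-homo
      ; 0-homo = refl
      ; 1-homo = refl
      }

    coeff≟ : ∀ i j → Maybe (⟦ i ⟧ ≈ ⟦ j ⟧)
    coeff≟ i j with i ℤ.≟ j
    ... | yes ≡.refl = just refl
    ... | no  _      = nothing

  open Algebra.Solver.Ring ℤ.+-*-rawRing (fromCommutativeRing R) morphism coeff≟ public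
    using (solve; _:=_; _:+_; _:*_; _:-_; :-_; con)

-- Order, density and absolute-value estimates in an ordered field.

module OrderedField (ℝ : CompleteOrderedField) where

  open Calculus ℝ
  open IntegerSolver commutativeRing
  open Algebra.Properties.Ring ring
    using (-0#≈0#; -‿+-comm; x≈y⇒x∙y⁻¹≈ε; x∙y⁻¹≈ε⇒x≈y)
  module < = IsStrictTotalOrder isStrictTotalOrder

  abstract

    <-trans : ∀ {x y z} → x < y → y < z → x < z
    <-trans = <.trans

    <-respˡ : ∀ {x y z} → x ≈ y → x < z → y < z
    <-respˡ = <.<-respˡ-≈

    <-respʳ : ∀ {x y z} → y ≈ z → x < y → x < z
    <-respʳ = <.<-respʳ-≈

    <-resp : ∀ {x x′ y y′} → x ≈ x′ → y ≈ y′ → x < y → x′ < y′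
    <-resp p q r = <-respˡ p (<-respʳ q r)

    <-irrefl : ∀ {x} → ¬ (x < x)
    <-irrefl = <.irrefl refl

    <-≤-trans : ∀ {x y z} → x < y → y ≤ z → x < z
    <-≤-trans = StrictToNonStrict.<-≤-trans _≈_ _<_ <-trans <-respʳ

    ≤-<-trans : ∀ {x y z} → x ≤ y → y < z → x < z
    ≤-<-trans = StrictToNonStrict.≤-<-trans _≈_ _<_ sym <-trans <-respˡ

    ≤-trans : ∀ {x y z} → x ≤ y → y ≤ z → x ≤ z
    ≤-trans = StrictToNonStrict.trans _≈_ _<_ isEquivalence <.<-resp-≈ <-trans

    ≤-refl : ∀ {x} → x ≤ x
    ≤-refl = inj₂ refl

    ≤-antisym : ∀ {x y} → x ≤ y → y ≤ x → x ≈ y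
    ≤-antisym = StrictToNonStrict.antisym _≈_ _<_ isEquivalence <-trans <.irrefl

    <⇒≱ : ∀ {x y} → x < y → ¬ (y ≤ x)
    <⇒≱ x<y y≤x = <-irrefl (<-≤-trans x<y y≤x)

    <-or-≥ : ∀ x y → x < y ⊎ y ≤ x
    <-or-≥ x y with <.compare x y
    ... | tri< x<y _ _ = inj₁ x<y
    ... | tri≈ _ x≈y _ = inj₂ (inj₂ (sym x≈y))
    ... | tri> _ _ x>y = inj₂ (inj₁ x>y)

    <⇒≉ : ∀ {x y} → x < y → x ≉ y
    <⇒≉ x<y x≈y = <.irrefl x≈y x<y

    >⇒≉ : ∀ {x y} → y < x → x ≉ y
    >⇒≉ y<x x≈y = <.irrefl (sym x≈y) y<x

    min-bound : ∀ {x} a b → x < a → x < b → ∃ λ m → x < m × m ≤ a × m ≤ b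
    min-bound a b x<a x<b with <-or-≥ a b
    ... | inj₁ a<b = a , x<a , ≤-refl , inj₁ a<b
    ... | inj₂ b≤a = b , x<b , b≤a , ≤-refl

    max-bound : ∀ {x} a b → a < x → b < x → ∃ λ m → m < x × a ≤ m × b ≤ m
    max-bound a b a<x b<x with <-or-≥ a b
    ... | inj₁ a<b = b , b<x , inj₁ a<b , ≤-refl
    ... | inj₂ b≤a = a , a<x , ≤-refl , b≤a

    +-mono-< : ∀ {a b c d} → a < b → c < d → a + c < b + d
    +-mono-< {a} {b} {c} {d} a<b c<d =
      <-trans (+-monoʳ-< a c<d) (<-resp (+-comm d a) (+-comm d b) (+-monoʳ-< d a<b))

    +-monoˡ-< : ∀ z {x y} → x < y → x + z < y + z
    +-monoˡ-< z {x} {y} x<y = <-resp (+-comm z x) (+-comm z y) (+-monoʳ-< z x<y)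

    <⇒0<- : ∀ {x y} → x < y → 0# < y - x
    <⇒0<- {x} {y} x<y = <-respˡ (-‿inverseʳ x) (+-monoˡ-< (- x) x<y)

    <⇒-<0 : ∀ {x y} → x < y → x - y < 0#
    <⇒-<0 {y = y} x<y = <-respʳ (-‿inverseʳ y) (+-monoˡ-< (- y) x<y)

    0<-⇒< : ∀ {x y} → 0# < y - x → x < y
    0<-⇒< {x} {y} p = <-resp (+-identityʳ x)
      (solve 2 (λ x y → x :+ (y :- x) := y) refl x y) (+-monoʳ-< x p)

    neg-anti-< : ∀ {x y} → x < y → - y < - x
    neg-anti-< {x} {y} x<y = 0<-⇒< (<-respʳ
      (solve 2 (λ x y → y :- x := :- x :- :- y) refl x y) (<⇒0<- x<y))

    neg-pos : ∀ {x} → 0# < x → - x < 0#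
    neg-pos 0<x = <-respʳ -0#≈0# (neg-anti-< 0<x)

    neg-neg : ∀ {x} → x < 0# → 0# < - x
    neg-neg x<0 = <-respˡ -0#≈0# (neg-anti-< x<0)

    +-pos : ∀ {x y} → 0# < x → 0# < y → 0# < x + y
    +-pos p q = <-respˡ (+-identityʳ 0#) (+-mono-< p q)

    *-neg-neg : ∀ {x y} → x < 0# → y < 0# → 0# < x * y
    *-neg-neg {x} {y} x<0 y<0 = <-respʳ
      (solve 2 (λ x y → :- x :* :- y := x :* y) refl x y) (*-pos (neg-neg x<0) (neg-neg y<0))

    *-pos-neg : ∀ {x y} → 0# < x → y < 0# → x * y < 0#
    *-pos-neg {x} {y} 0<x y<0 = <-resp
      (solve 2 (λ x y → :- (x :* :- y) := x :* y) refl x y) -0#≈0#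
      (neg-anti-< (*-pos 0<x (neg-neg y<0)))

    ≉0⇒0<square : ∀ {x} → x ≉ 0# → 0# < x * x
    ≉0⇒0<square {x} x≉0 with <.compare x 0#
    ... | tri< x<0 _ _ = *-neg-neg x<0 x<0
    ... | tri≈ _ x≈0 _ = ⊥-elim (x≉0 x≈0)
    ... | tri> _ _ 0<x = *-pos 0<x 0<x

    0<1 : 0# < 1#
    0<1 = <-respʳ (*-identityʳ 1#) (≉0⇒0<square (λ 1≈0 → 0≉1 (sym 1≈0)))

    0<x+x⇒0<x : ∀ {x} → 0# < x + x → 0# < x
    0<x+x⇒0<x {x} 0<2x with <.compare x 0#
    ... | tri< x<0 _ _ = ⊥-elim (<-irrefl (<-trans 0<2x (<-respʳ (+-identityʳ 0#) (+-mono-< x<0 x<0))))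
    ... | tri≈ _ x≈0 _ = ⊥-elim (<-irrefl (<-respʳ (trans (+-cong x≈0 x≈0) (+-identityʳ 0#)) 0<2x))
    ... | tri> _ _ 0<x = 0<x

    reciprocal-pos : ∀ {x y} → 0# < x → x * y ≈ 1# → 0# < y
    reciprocal-pos {x} {y} 0<x xy≈1 with <.compare y 0#
    ... | tri< y<0 _ _ = ⊥-elim (<-irrefl (<-trans 0<1 (<-respˡ xy≈1 (*-pos-neg 0<x y<0))))
    ... | tri≈ _ y≈0 _ = ⊥-elim (0≉1 (trans (sym (zeroʳ x)) (trans (*-congˡ (sym y≈0)) xy≈1)))
    ... | tri> _ _ 0<y = 0<y

    -- `inv` takes a proof as an argument; uniqueness of inverses supplies its congruence and its
    -- independence of that proof.
    inverse-unique : ∀ {x y u w} → x ≈ y → x * u ≈ 1# → y * w ≈ 1# → u ≈ w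
    inverse-unique {x} {y} {u} {w} x≈y xu≈1 yw≈1 = begin
      u           ≈⟨ *-identityʳ u ⟨
      u * 1#      ≈⟨ *-congˡ (trans (*-congʳ x≈y) yw≈1) ⟨
      u * (x * w) ≈⟨ solve 3 (λ x u w → u :* (x :* w) := (x :* u) :* w) refl x u w ⟩
      (x * u) * w ≈⟨ *-congʳ xu≈1 ⟩
      1# * w      ≈⟨ *-identityˡ w ⟩
      w           ∎
      where open Relation.Binary.Reasoning.Setoid setoid

    divide : ∀ {ε c} → 0# < ε → 0# < c → ∃ λ e → 0# < e × c * e ≈ ε
    divide {ε} {c} 0<ε 0<c = inv c c≉0 * ε , *-pos (reciprocal-pos 0<c (*-invʳ c c≉0)) 0<ε ,
      trans (sym (*-assoc _ _ _)) (trans (*-congʳ (*-invʳ c c≉0)) (*-identityˡ ε))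
      where
      c≉0 : c ≉ 0#
      c≉0 = >⇒≉ 0<c

    halve : ∀ {ε} → 0# < ε → ∃ λ e → 0# < e × e + e ≈ ε
    halve 0<ε with divide 0<ε (+-pos 0<1 0<1)
    ... | e , 0<e , 2e≈ε = e , 0<e ,
      trans (solve 1 (λ e → e :+ e := (con (ℤ.+ 1) :+ con (ℤ.+ 1)) :* e) refl e) 2e≈ε

    dense : ∀ {x y} → x < y → ∃ λ m → x < m × m < y
    dense {x} {y} x<y with halve (<⇒0<- x<y)
    ... | e , 0<e , 2e≈ = x + e ,
      <-respˡ (+-identityʳ x) (+-monoʳ-< x 0<e) ,
      <-resp (+-identityʳ _) (trans (+-assoc x e e) (trans (+-congˡ 2e≈)
        (solve 2 (λ x y → x :+ (y :- x) := y) refl x y))) (+-monoʳ-< (x + e) 0<e)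

    x<x+ : ∀ x {e} → 0# < e → x < x + e
    x<x+ x 0<e = <-respˡ (+-identityʳ x) (+-monoʳ-< x 0<e)

    x-<x : ∀ x {e} → 0# < e → x - e < x
    x-<x x 0<e = <-respʳ (+-identityʳ x) (+-monoʳ-< x (neg-pos 0<e))

  -- The two halves of ∣ x ∣ < e, free of the case distinction in ∣_∣.

  infix 4 _≪_

  record _≪_ (x e : Carrier) : Set where
    constructor bounds
    field
      upper : x < e
      lower : - x < e

  open _≪_ public

  abstract

    ≪⇒∣∣< : ∀ {x e} → x ≪ e → ∣ x ∣ < e
    ≪⇒∣∣< {x} (bounds p q) with x <.<? 0#
    ... | yes _ = q
    ... | no  _ = p

    ∣∣<⇒≪ : ∀ {x e} → ∣ x ∣ < e → x ≪ e
    ∣∣<⇒≪ {x} p with x <.<? 0#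
    ... | yes x<0 = bounds (<-trans x<0 (<-trans (neg-neg x<0) p)) p
    ... | no  x≮0 with <-or-≥ x 0#
    ...   | inj₁ x<0 = ⊥-elim (x≮0 x<0)
    ...   | inj₂ (inj₁ 0<x) = bounds p (<-trans (neg-pos 0<x) (<-trans 0<x p))
    ...   | inj₂ (inj₂ 0≈x) = bounds p
            (<-respˡ (trans (sym 0≈x) (trans (sym -0#≈0#) (-‿cong 0≈x))) p)

    ≪-lower : ∀ {x c e} → x - c ≪ e → c - e < x
    ≪-lower {x} {c} {e} p = <-resp (+-comm _ c)
      (solve 2 (λ x c → :- :- (x :- c) :+ c := x) refl x c)
      (+-monoˡ-< c (neg-anti-< (lower p)))

    ≪-between : ∀ {x c e} → c - e < x → x < c + e → x - c ≪ e
    ≪-between {x} {c} {e} p q =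
      bounds
      (<-respʳ (solve 2 (λ c e → (c :+ e) :- c := e) refl c e) (+-monoˡ-< (- c) q))
      (<-resp (solve 2 (λ x c → :- x :+ c := :- (x :- c)) refl x c)
        (solve 2 (λ c e → :- (c :- e) :+ c := e) refl c e) (+-monoˡ-< c (neg-anti-< p)))

    0≪ : ∀ {e} → 0# < e → 0# ≪ e
    0≪ 0<e = bounds 0<e (<-respˡ (sym -0#≈0#) 0<e)

    ≪-resp : ∀ {x y e} → x ≈ y → x ≪ e → y ≪ e
    ≪-resp x≈y (bounds a b) = bounds (<-respˡ x≈y a) (<-respˡ (-‿cong x≈y) b)

    ≪-weaken : ∀ {x d e} → d ≤ e → x ≪ d → x ≪ e
    ≪-weaken d≤e (bounds a b) = bounds (<-≤-trans a d≤e) (<-≤-trans b d≤e)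

    ≉0⇒¬≪ : ∀ {x} → x ≉ 0# → ∃ λ e → 0# < e × ¬ (x ≪ e)
    ≉0⇒¬≪ {x} x≉0 with <.compare x 0#
    ... | tri< x<0 _ _ = - x , neg-neg x<0 , λ p → <-irrefl (lower p)
    ... | tri≈ _ x≈0 _ = ⊥-elim (x≉0 x≈0)
    ... | tri> _ _ 0<x = x , 0<x , λ p → <-irrefl (upper p)

    ≪-+ : ∀ {x y d e} → x ≪ d → y ≪ e → x + y ≪ d + e
    ≪-+ {x} {y} (bounds a b) (bounds c d) = bounds (+-mono-< a c) (<-respˡ (-‿+-comm x y) (+-mono-< b d))

    -- (d - x)(e + y) + (d + x)(e - y) = 2(de - xy) and (d - x)(e - y) + (d + x)(e + y) = 2(de + xy)
    -- are sums of positive products, so no case distinction on signs arises.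
    ≪-* : ∀ {x y d e} → x ≪ d → y ≪ e → x * y ≪ d * e
    ≪-* {x} {y} {d} {e} (bounds x<d -x<d) (bounds y<e -y<e) =
      bounds
      (0<-⇒< (0<x+x⇒0<x (<-respʳ
        (solve 4 (λ x y d e → (d :- x) :* (e :- :- y) :+ (d :- :- x) :* (e :- y)
                   := (d :* e :- x :* y) :+ (d :* e :- x :* y)) refl x y d e)
        (+-pos (*-pos (<⇒0<- x<d) (<⇒0<- -y<e)) (*-pos (<⇒0<- -x<d) (<⇒0<- y<e))))))
      (0<-⇒< (0<x+x⇒0<x (<-respʳ
        (solve 4 (λ x y d e → (d :- x) :* (e :- y) :+ (d :- :- x) :* (e :- :- y)
                   := (d :* e :- :- (x :* y)) :+ (d :* e :- :- (x :* y))) refl x y d e)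
        (+-pos (*-pos (<⇒0<- x<d) (<⇒0<- y<e)) (*-pos (<⇒0<- -x<d) (<⇒0<- -y<e))))))

    ≪-bound : ∀ x → ∃ λ c → 0# < c × x ≪ c
    ≪-bound x with <-or-≥ x 0#
    ... | inj₁ x<0 = 1# - x , <-trans (neg-neg x<0) -x<1-x , bounds (<-trans x<0 (<-trans (neg-neg x<0) -x<1-x)) -x<1-x
      where
      -x<1-x : - x < 1# - x
      -x<1-x = <-respˡ (+-identityˡ _) (+-monoˡ-< (- x) 0<1)
    ... | inj₂ 0≤x = 1# + x , ≤-<-trans 0≤x x<1+x , bounds x<1+x (≤-<-trans (-x≤x 0≤x) x<1+x)
      where
      x<1+x : x < 1# + x
      x<1+x = <-respˡ (+-identityˡ _) (+-monoˡ-< x 0<1)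
      -x≤x : 0# ≤ x → - x ≤ x
      -x≤x (inj₁ 0<x) = inj₁ (<-trans (neg-pos 0<x) 0<x)
      -x≤x (inj₂ 0≈x) = inj₂ (trans (-‿cong (sym 0≈x)) (trans -0#≈0# 0≈x))

    ≪ε⇒≈0 : ∀ {x} → (∀ ε → 0# < ε → x ≪ ε) → x ≈ 0#
    ≪ε⇒≈0 {x} small with <.compare x 0#
    ... | tri< x<0 _ _ = ⊥-elim (<-irrefl (lower (small (- x) (neg-neg x<0))))
    ... | tri≈ _ x≈0 _ = x≈0
    ... | tri> _ _ 0<x = ⊥-elim (<-irrefl (upper (small x 0<x)))

    ≈⇒-≈0 : ∀ {x y} → x ≈ y → x - y ≈ 0#
    ≈⇒-≈0 = x≈y⇒x∙y⁻¹≈ε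

    -≈0⇒≈ : ∀ {x y} → x - y ≈ 0# → x ≈ y
    -≈0⇒≈ = x∙y⁻¹≈ε⇒x≈y _ _

-- Limits, and derivatives as continuous slopes.

module Differentiation (ℝ : CompleteOrderedField) where

  open Calculus ℝ
  open OrderedField ℝ
  open IntegerSolver commutativeRing
  open Relation.Binary.Reasoning.Setoid setoid

  module _ {S : Subset} where

    -- With the radius hidden behind `near-map` and `near-∧`, most limit proofs become pointwise
    -- estimates.
    record Near (a : Point S) (P : Point S → Set) : Set where
      constructor near
      field
        radius   : Carrier
        0<radius : 0# < radius
        within   : ∀ x → proj₁ x - proj₁ a ≪ radius → P x

    abstract

      near-map : ∀ {a P Q} → (∀ x → P x → Q x) → Near a P → Near a Q
      near-map P⇒Q (near δ 0<δ p) = near δ 0<δ λ x x≈a → P⇒Q x (p x x≈a)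

      near-∧ : ∀ {a P Q} → Near a P → Near a Q → Near a (λ x → P x × Q x)
      near-∧ (near δ 0<δ p) (near ε 0<ε q) with min-bound δ ε 0<δ 0<ε
      ... | η , 0<η , η≤δ , η≤ε = near η 0<η
        λ x x≈a → p x (≪-weaken η≤δ x≈a) , q x (≪-weaken η≤ε x≈a)

    -- Only the values at points other than a matter in a derivative, but it
    -- is harmless, and simpler, to let limits see the value at a: the limits
    -- below are all of functions continuous at a.

    record Lim (h : Point S → Carrier) (a : Point S) (L : Carrier) : Set where
      constructor lim
      field
        close : ∀ ε → 0# < ε → Near a (λ x → h x - L ≪ ε)

    open Lim public

    abstract

      lim-cong : ∀ {h k a L M} → (∀ x → h x ≈ k x) → L ≈ M → Lim h a L → Lim k a M
      lim-cong h≈k L≈M h→L = lim λ ε 0<ε →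
        near-map (λ x → ≪-resp (+-cong (h≈k x) (-‿cong L≈M))) (close h→L ε 0<ε)

      lim-const : ∀ {a} c → Lim (λ _ → c) a c
      lim-const c = lim λ ε 0<ε → near 1# 0<1 λ _ _ →
        ≪-resp (sym (-‿inverseʳ c)) (0≪ 0<ε)

      lim-+ : ∀ {h k a L M} → Lim h a L → Lim k a M → Lim (λ x → h x + k x) a (L + M)
      lim-+ {h} {k} {a} {L} {M} h→L k→M = lim λ ε 0<ε → let e , 0<e , 2e≈ε = halve 0<ε in near-map
        (λ { x (p , q) → ≪-weaken (inj₂ 2e≈ε) (≪-resp
          (solve 4 (λ h k L M → (h :- L) :+ (k :- M) := (h :+ k) :- (L :+ M)) refl (h x) (k x) L M)
          (≪-+ p q)) })
        (near-∧ (close h→L e 0<e) (close k→M e 0<e))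

      -- The one ε-estimate for products: `lim-*` and `lim-reciprocal-pos` reduce to it by algebraic
      -- identities.
      lim-bounded-*-null : ∀ {h k : Point S → Carrier} {a B} → 0# < B → Near a (λ x → h x ≪ B) →
                           Lim k a 0# → Lim (λ x → h x * k x) a 0#
      lim-bounded-*-null {h} {k} 0<B h≪B k→0 = lim λ ε 0<ε → let e , 0<e , Be≈ε = divide 0<ε 0<B in near-map
        (λ { x (p , q) → ≪-weaken (inj₂ Be≈ε) (≪-resp
          (solve 2 (λ h k → h :* (k :- con ℤ.0ℤ) := h :* k :- con ℤ.0ℤ) refl (h x) (k x))
          (≪-* p q)) })
        (near-∧ h≪B (close k→0 e 0<e))

      lim-null : ∀ {h a L} → Lim h a L → Lim (λ x → h x - L) a 0#
      lim-null {h} {a} {L} h→L = lim-cong (λ _ → refl) (-‿inverseʳ L) (lim-+ h→L (lim-const (- L)))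

      lim⇒bounded : ∀ {h a L} → Lim h a L → ∃ λ B → 0# < B × Near a (λ x → h x ≪ B)
      lim⇒bounded {h} {a} {L} h→L with ≪-bound L
      ... | B , 0<B , L≪B = 1# + B , +-pos 0<1 0<B , near-map
        (λ x p → ≪-resp (solve 2 (λ h L → (h :- L) :+ L := h) refl (h x) L) (≪-+ p L≪B))
        (close h→L 1# 0<1)

      -- In h k = h (k - M) + M (h - L) + L M, each of the first two products has one factor bounded
      -- near a and one tending to 0.
      lim-* : ∀ {h k a L M} → Lim h a L → Lim k a M → Lim (λ x → h x * k x) a (L * M)
      lim-* {h} {k} {a} {L} {M} h→L k→M with lim⇒bounded h→L | ≪-bound M
      ... | B , 0<B , h≪B | C , 0<C , M≪C = lim-cong
        (λ x → solve 4 (λ h k L M → (h :* (k :- M) :+ M :* (h :- L)) :+ L :* M := h :* k) refl (h x) (k x) L M)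
        (trans (+-congʳ (+-identityˡ 0#)) (+-identityˡ _))
        (lim-+ (lim-+ (lim-bounded-*-null 0<B h≪B (lim-null k→M))
                      (lim-bounded-*-null 0<C (near 1# 0<1 λ _ _ → M≪C) (lim-null h→L)))
               (lim-const (L * M)))

      lim-neg : ∀ {h a L} → Lim h a L → Lim (λ x → - h x) a (- L)
      lim-neg {h} {a} {L} h→L = lim-cong (λ x → neg (h x)) (neg L) (lim-* (lim-const (- 1#)) h→L)
        where
        neg : ∀ x → - 1# * x ≈ - x
        neg = solve 1 (λ x → :- con ℤ.1ℤ :* x := :- x) refl

      -- Plain maps on points carry no congruence. For continuous ones this lemma supplies it, as
      -- limits include the value at every point equal to a.
      lim⇒≈ : ∀ {h a L} → Lim h a L → ∀ x → proj₁ x ≈ proj₁ a → h x ≈ L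
      lim⇒≈ {a = a} h→L x x≈a = -≈0⇒≈ (≪ε⇒≈0 λ ε 0<ε → small (close h→L ε 0<ε))
        where
        small : ∀ {P} → Near a P → P x
        small (near δ 0<δ p) = p x (≪-resp (sym (≈⇒-≈0 x≈a)) (0≪ 0<δ))

      lim-pos : ∀ {h a L} → Lim h a L → 0# < L → Near a (λ x → 0# < h x)
      lim-pos {h} {a} {L} h→L 0<L =
        near-map (λ x p → <-respˡ (-‿inverseʳ L) (≪-lower p)) (close h→L L 0<L)

      -- v - w = v · w (L - h), where the second factor tends to 0. The first is bounded by 2w: near
      -- a both h and 2h - L are positive, hence so are v and v · w (2h - L) = 2w - v.
      lim-reciprocal-pos : ∀ {h v a L w} → (∀ x → h x * v x ≈ 1#) → L * w ≈ 1# → 0# < L →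
                           Lim h a L → Lim v a w
      lim-reciprocal-pos {h} {v} {a} {L} {w} hv≈1 Lw≈1 0<L h→L =
        lim-cong (λ x → v≈ (h x) (v x) (hv≈1 x)) (+-identityˡ w)
          (lim-+ (lim-bounded-*-null (+-pos 0<w 0<w) v≪2w w[L-h]→0) (lim-const w))
        where
        0<w : 0# < w
        0<w = reciprocal-pos 0<L Lw≈1

        w[L-h]→0 : Lim (λ x → w * (L - h x)) a 0#
        w[L-h]→0 = lim-cong (λ _ → refl) (trans (*-congˡ (-‿inverseʳ L)) (zeroʳ w))
          (lim-* (lim-const w) (lim-+ (lim-const L) (lim-neg h→L)))

        v≈ : ∀ h v → h * v ≈ 1# → v * (w * (L - h)) + w ≈ v
        v≈ h v hv≈1 = begin
          v * (w * (L - h)) + w              ≈⟨ solve 4 (λ h v w L → v :* (w :* (L :- h)) :+ w := v :* (L :* w) :+ w :* (con ℤ.1ℤ :- h :* v)) refl h v w L ⟩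
          v * (L * w) + w * (1# - h * v)     ≈⟨ +-cong (*-congˡ Lw≈1) (*-congˡ (+-congˡ (-‿cong hv≈1))) ⟩
          v * 1# + w * (1# - 1#)             ≈⟨ solve 2 (λ v w → v :* con ℤ.1ℤ :+ w :* (con ℤ.1ℤ :- con ℤ.1ℤ) := v) refl v w ⟩
          v                                  ∎

        2w-v≈ : ∀ h v → h * v ≈ 1# → v * (w * ((h + h) - L)) ≈ (w + w) - v
        2w-v≈ h v hv≈1 = begin
          v * (w * ((h + h) - L))              ≈⟨ solve 4 (λ h v w L → v :* (w :* ((h :+ h) :- L)) := w :* (h :* v) :+ w :* (h :* v) :- v :* (L :* w)) refl h v w L ⟩
          w * (h * v) + w * (h * v) - v * (L * w) ≈⟨ +-cong (+-cong (*-congˡ hv≈1) (*-congˡ hv≈1)) (-‿cong (*-congˡ Lw≈1)) ⟩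
          w * 1# + w * 1# - v * 1#             ≈⟨ +-cong (+-cong (*-identityʳ w) (*-identityʳ w)) (-‿cong (*-identityʳ v)) ⟩
          (w + w) - v                          ∎

        v≪2w : Near a (λ x → v x ≪ w + w)
        v≪2w = near-map
          (λ { x (0<h , 0<2h-L) → let 0<v = reciprocal-pos 0<h (hv≈1 x) in
               bounds (0<-⇒< (<-respʳ (2w-v≈ (h x) (v x) (hv≈1 x)) (*-pos 0<v (*-pos 0<w 0<2h-L))))
                      (<-trans (neg-pos 0<v) (+-pos 0<w 0<w)) })
          (near-∧ (lim-pos h→L 0<L)
                  (lim-pos (lim-+ (lim-+ h→L h→L) (lim-const (- L)))
                    (<-respʳ (solve 1 (λ L → L := (L :+ L) :- L) refl L) 0<L)))

      -- Through 1/h = h · 1/h², the sign of the limit does not matter.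

      lim-reciprocal : ∀ {h v a L w} → (∀ x → h x * v x ≈ 1#) → L * w ≈ 1# →
                       Lim h a L → Lim v a w
      lim-reciprocal {h} {v} {a} {L} {w} hv≈1 Lw≈1 h→L =
        lim-cong (λ x → cancel (h x) (v x) (hv≈1 x)) (cancel L w Lw≈1)
          (lim-* h→L (lim-reciprocal-pos
            (λ x → square (h x) (v x) (hv≈1 x)) (square L w Lw≈1) (≉0⇒0<square L≉0) (lim-* h→L h→L)))
        where
        L≉0 : L ≉ 0#
        L≉0 L≈0 = 0≉1 (trans (sym (zeroˡ w)) (trans (*-congʳ (sym L≈0)) Lw≈1))

        cancel : ∀ h v → h * v ≈ 1# → h * (v * v) ≈ v
        cancel h v hv≈1 = trans (sym (*-assoc h v v)) (trans (*-congʳ hv≈1) (*-identityˡ v))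

        square : ∀ h v → h * v ≈ 1# → (h * h) * (v * v) ≈ 1#
        square h v hv≈1 = trans (solve 2 (λ h v → (h :* h) :* (v :* v) := (h :* v) :* (h :* v)) refl h v)
          (trans (*-cong hv≈1 hv≈1) (*-identityʳ 1#))

    -- As `Lim` takes in the point a itself, the slope has the value L there. The rules of
    -- differentiation become identities between slopes, without division by a difference that may
    -- vanish.
    record Differentiable (h : Point S → Carrier) (a : Point S) (L : Carrier) : Set where
      field
        slope   : Point S → Carrier
        secant  : ∀ x → h x - h a ≈ slope x * (proj₁ x - proj₁ a)
        slope→L : Lim slope a L

    open Differentiable public

    abstract

      fromHasDerivative : ∀ (h : Fun S) {a L} → HasDerivativeAt h a L → Differentiable (h ⟨$⟩_) a L
      fromHasDerivative h {a} {L} der = record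
        { slope   = slp
        ; secant  = sec
        ; slope→L = lim slp→L
        }
        where
        quot : (x : Point S) → Dec (proj₁ x - proj₁ a ≈ 0#) → Carrier
        -- The difference quotient is undefined here; L is the value that makes the slope continuous
        -- at a.
        quot x (yes _)    = L
        quot x (no x-a≉0) = (h ⟨$⟩ x - h ⟨$⟩ a) * inv (proj₁ x - proj₁ a) x-a≉0

        slp : Point S → Carrier
        slp x = quot x ((proj₁ x - proj₁ a) <.≟ 0#)

        sec : ∀ (x : Point S) → h ⟨$⟩ x - h ⟨$⟩ a ≈ slp x * (proj₁ x - proj₁ a)
        sec x with (proj₁ x - proj₁ a) <.≟ 0#
        ... | yes x-a≈0 = trans (≈⇒-≈0 (Func.cong h {x} {a} (-≈0⇒≈ x-a≈0))) (sym (trans (*-congˡ x-a≈0) (zeroʳ L)))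
        ... | no  x-a≉0 = sym (trans (*-assoc _ _ _) (trans (*-congˡ (trans (*-comm _ _) (*-invʳ _ x-a≉0))) (*-identityʳ _)))

        slp→L : ∀ ε → 0# < ε → Near a (λ x → slp x - L ≪ ε)
        slp→L ε 0<ε with der ε 0<ε
        ... | δ , 0<δ , p = near δ 0<δ slp≪
          where
          slp≪ : ∀ (x : Point S) → proj₁ x - proj₁ a ≪ δ → slp x - L ≪ ε
          slp≪ x x-a≪δ with (proj₁ x - proj₁ a) <.≟ 0#
          ... | yes _     = ≪-resp (sym (-‿inverseʳ L)) (0≪ 0<ε)
          ... | no  x-a≉0 = ∣∣<⇒≪ (p x x-a≉0 (≪⇒∣∣< x-a≪δ))

      toHasDerivative : ∀ (h : Fun S) {a L} → Differentiable (h ⟨$⟩_) a L → HasDerivativeAt h a L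
      toHasDerivative h {a} {L} d ε 0<ε with close (slope→L d) ε 0<ε
      ... | near δ 0<δ p = δ , 0<δ , λ x x-a≉0 x-a<δ → ≪⇒∣∣< (≪-resp
        (+-congʳ (sym (trans (*-congʳ (secant d x)) (trans (*-assoc _ _ _)
          (trans (*-congˡ (*-invʳ _ x-a≉0)) (*-identityʳ _))))))
        (p x (∣∣<⇒≪ x-a<δ)))

    abstract

      d-cong : ∀ {h k a L M} → (∀ x → h x ≈ k x) → L ≈ M → Differentiable h a L → Differentiable k a M
      d-cong {a = a} h≈k L≈M d = record
        { slope   = slope d
        ; secant  = λ x → trans (+-cong (sym (h≈k x)) (-‿cong (sym (h≈k a)))) (secant d x)
        ; slope→L = lim-cong (λ _ → refl) L≈M (slope→L d)
        }

      d-const : ∀ {a} c → Differentiable (λ _ → c) a 0#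
      d-const c = record
        { slope   = λ _ → 0#
        ; secant  = λ x → trans (-‿inverseʳ c) (sym (zeroˡ _))
        ; slope→L = lim-const 0#
        }

      d-+ : ∀ {h k a L M} → Differentiable h a L → Differentiable k a M →
            Differentiable (λ x → h x + k x) a (L + M)
      d-+ {h} {k} {a} c d = record
        { slope   = λ x → slope c x + slope d x
        ; secant  = λ x → trans
            (solve 4 (λ h k h′ k′ → (h :+ k) :- (h′ :+ k′) := (h :- h′) :+ (k :- k′)) refl (h x) (k x) (h a) (k a))
            (trans (+-cong (secant c x) (secant d x)) (sym (distribʳ _ _ _)))
        ; slope→L = lim-+ (slope→L c) (slope→L d)
        }

      lim-identity : ∀ {a} → Lim proj₁ a (proj₁ a)
      lim-identity = lim λ ε 0<ε → near ε 0<ε λ x p → p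

      d⇒lim : ∀ {h a L} → Differentiable h a L → Lim h a (h a)
      d⇒lim {h} {a} {L} d = lim-cong
        (λ x → trans (+-congʳ (sym (secant d x))) (solve 2 (λ h h′ → (h :- h′) :+ h′ := h) refl (h x) (h a)))
        (trans (+-congʳ (trans (*-congˡ (-‿inverseʳ _)) (zeroʳ L))) (+-identityˡ _))
        (lim-+ (lim-* (slope→L d) (lim-+ lim-identity (lim-const (- proj₁ a)))) (lim-const (h a)))

      d-* : ∀ {h k a L M} → Differentiable h a L → Differentiable k a M →
            Differentiable (λ x → h x * k x) a (L * k a + h a * M)
      d-* {h} {k} {a} c d = record
        { slope   = λ x → slope c x * k x + h a * slope d x
        ; secant  = λ x → trans
            (solve 4 (λ h k h′ k′ → h :* k :- h′ :* k′ := (h :- h′) :* k :+ h′ :* (k :- k′)) refl (h x) (k x) (h a) (k a))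
            (trans (+-cong (*-congʳ (secant c x)) (*-congˡ (secant d x)))
              (solve 5 (λ s t k h′ x → (s :* x) :* k :+ h′ :* (t :* x) := (s :* k :+ h′ :* t) :* x) refl
                (slope c x) (slope d x) (k x) (h a) (proj₁ x - proj₁ a)))
        ; slope→L = lim-+ (lim-* (slope→L c) (d⇒lim d)) (lim-* (lim-const (h a)) (slope→L d))
        }

      d-neg : ∀ {h t L} → Differentiable h t L → Differentiable (λ x → - h x) t (- L)
      d-neg {h} {t} {L} d = d-cong
        (λ x → solve 1 (λ y → :- con ℤ.1ℤ :* y := :- y) refl (h x))
        (solve 2 (λ L y → con ℤ.0ℤ :* y :+ :- con ℤ.1ℤ :* L := :- L) refl L (h t))
        (d-* (d-const (- 1#)) d)

      d-reciprocal : ∀ {h v a L} → (∀ x → h x * v x ≈ 1#) → Differentiable h a L →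
                     Differentiable v a (- (L * (v a * v a)))
      d-reciprocal {h} {v} {a} {L} hv≈1 d = record
        { slope   = λ x → - (slope d x * (v x * v a))
        ; secant  = λ x → begin
            v x - v a                              ≈⟨ +-cong (sym (*-identityʳ _)) (-‿cong (sym (*-identityʳ _))) ⟩
            v x * 1# - v a * 1#                    ≈⟨ +-cong (*-congˡ (sym (hv≈1 a))) (-‿cong (*-congˡ (sym (hv≈1 x)))) ⟩
            v x * (h a * v a) - v a * (h x * v x)  ≈⟨ solve 4 (λ v v′ h h′ → v :* (h′ :* v′) :- v′ :* (h :* v) := :- ((h :- h′) :* (v :* v′))) refl (v x) (v a) (h x) (h a) ⟩
            - ((h x - h a) * (v x * v a))          ≈⟨ -‿cong (*-congʳ (secant d x)) ⟩
            - ((slope d x * (proj₁ x - proj₁ a)) * (v x * v a)) ≈⟨ solve 3 (λ s x v → :- ((s :* x) :* v) := :- (s :* v) :* x) refl (slope d x) (proj₁ x - proj₁ a) (v x * v a) ⟩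
            - (slope d x * (v x * v a)) * (proj₁ x - proj₁ a) ∎
        ; slope→L = lim-neg (lim-* (slope→L d)
            (lim-* (lim-reciprocal hv≈1 (hv≈1 a) (d⇒lim d)) (lim-const (v a))))
        }

-- Strict monotonicity from a derivative without zeros, and the derivative along the inverse.

module InverseFunction (em : ExcludedMiddle 0ℓ) (ℝ : CompleteOrderedField) where

  open Calculus ℝ
  open OrderedField ℝ
  open Differentiation ℝ
  open IntegerSolver commutativeRing
  open AddExtrema _<_ using (_<±_; ⊥±<[_]; [_]; [_]<⊤±)

  <±-≤-trans : ∀ {a x y} → a <± [ x ] → x ≤ y → a <± [ y ]
  <±-≤-trans ⊥±<[ _ ] _   = ⊥±<[ _ ]
  <±-≤-trans [ a<x ]  x≤y = [ <-≤-trans a<x x≤y ]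

  ≤-<±-trans : ∀ {b x y} → x ≤ y → [ y ] <± b → [ x ] <± b
  ≤-<±-trans _   [ _ ]<⊤± = [ _ ]<⊤±
  ≤-<±-trans x≤y [ y<b ]  = [ ≤-<-trans x≤y y<b ]

  module _ {a b : Carrier ±} where

    private J = OpenInterval a b

    convex : ∀ {x y z} → J x → x ≤ y → y ≤ z → J z → J y
    convex (a<x , _) x≤y y≤z (_ , z<b) = <±-≤-trans a<x x≤y , ≤-<±-trans y≤z z<b

    fromPast : ∀ {x} → [ x ] <± b → ∃ λ y → x < y × [ y ] <± b
    fromPast {x} [ _ ]<⊤± = x + 1# , x<x+ x 0<1 , [ _ ]<⊤±
    fromPast     [ x<b ]  with dense x<b
    ... | y , x<y , y<b = y , x<y , [ y<b ]

    fromBefore : ∀ {x} → a <± [ x ] → ∃ λ y → y < x × a <± [ y ]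
    fromBefore {x} ⊥±<[ _ ] = x - 1# , x-<x x 0<1 , ⊥±<[ _ ]
    fromBefore     [ a<x ]  with dense a<x
    ... | y , a<y , y<x = y , y<x , [ a<y ]

    pointAbove : ∀ (t : Point J) {δ} → 0# < δ → ∃ λ (v : Point J) → proj₁ t < proj₁ v × proj₁ v < proj₁ t + δ
    pointAbove (t , a<t , t<b) {δ} 0<δ with fromPast t<b
    ... | w , t<w , w<b with min-bound w (t + δ) t<w (x<x+ t 0<δ)
    ... | m , t<m , m≤w , m≤t+δ with dense t<m
    ... | v , t<v , v<m = (v , <±-≤-trans a<t (inj₁ t<v) , ≤-<±-trans (≤-trans (inj₁ v<m) m≤w) w<b) ,
                          t<v , <-≤-trans v<m m≤t+δ

    pointBelow : ∀ (t : Point J) {δ} → 0# < δ → ∃ λ (v : Point J) → proj₁ v < proj₁ t × proj₁ t - δ < proj₁ v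
    pointBelow (t , a<t , t<b) {δ} 0<δ with fromBefore a<t
    ... | w , w<t , a<w with max-bound w (t - δ) w<t (x-<x t 0<δ)
    ... | m , m<t , w≤m , t-δ≤m with dense m<t
    ... | v , m<v , v<t = (v , <±-≤-trans a<w (≤-trans w≤m (inj₁ m<v)) , ≤-<±-trans (inj₁ v<t) t<b) ,
                          v<t , ≤-<-trans t-δ≤m m<v

    _∈⟦_,_⟧ : Point J → Point J → Point J → Set
    u ∈⟦ x , z ⟧ = proj₁ x ≤ proj₁ u × proj₁ u ≤ proj₁ z

    IsMaximum : (Point J → Carrier) → Point J → Point J → Point J → Set
    IsMaximum h x z c = ∀ u → u ∈⟦ x , z ⟧ → h u ≤ h c

    -- If no value of h is a maximum, let c be the supremum of those s for
    -- which a single value of h exceeds all values on [x , s]. By continuity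
    -- that property extends past c.

    module ExtremeValue
      {h : Point J → Carrier} (cont : ∀ t → Lim h t (h t))
      {x z : Point J} (x≤z : proj₁ x ≤ proj₁ z)
      (noMax : ¬ (∃ λ c → c ∈⟦ x , z ⟧ × IsMaximum h x z c))
      where

      K : Point J → Set
      K u = u ∈⟦ x , z ⟧

      higher : ∀ t → K t → ∃ λ u → K u × h t < h u
      higher t Kt with em {∃ λ u → K u × h t < h u}
      ... | yes found = found
      ... | no  none  = ⊥-elim (noMax (t , Kt , maximal))
        where
        maximal : IsMaximum h x z t
        maximal u Ku with <-or-≥ (h t) (h u)
        ... | inj₁ ht<hu = ⊥-elim (none (u , Ku , ht<hu))
        ... | inj₂ hu≤ht = hu≤ht

      Exceeded : Carrier → Set
      Exceeded s = proj₁ x ≤ s × s ≤ proj₁ z ×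
        ∃ λ t → K t × (∀ u → proj₁ x ≤ proj₁ u → proj₁ u ≤ s → h u < h t)

      exceeded-x : Exceeded (proj₁ x)
      exceeded-x with higher x (≤-refl , x≤z)
      ... | t , Kt , hx<ht = ≤-refl , x≤z , t , Kt ,
        λ u x≤u u≤x → <-respˡ (sym (lim⇒≈ (cont x) u (≤-antisym u≤x x≤u))) hx<ht

      supremum : ∃ λ s → UpperBound Exceeded s × (∀ u → UpperBound Exceeded u → s ≤ u)
      supremum = complete Exceeded (proj₁ x , exceeded-x) (proj₁ z , λ _ p → proj₁ (proj₂ p))

      c = proj₁ supremum
      c-upper = proj₁ (proj₂ supremum)
      c-least = proj₂ (proj₂ supremum)

      x≤c : proj₁ x ≤ c
      x≤c = c-upper (proj₁ x) exceeded-x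

      c≤z : c ≤ proj₁ z
      c≤z = c-least (proj₁ z) (λ _ p → proj₁ (proj₂ p))

      cᴶ : Point J
      cᴶ = c , convex (proj₂ x) x≤c c≤z (proj₂ z)

      exceededNear : ∀ {δ} → 0# < δ → ∃ λ s → Exceeded s × c - δ < s
      exceededNear {δ} 0<δ with em {∃ λ s → Exceeded s × c - δ < s}
      ... | yes found = found
      ... | no  none  = ⊥-elim (<⇒≱ (x-<x c 0<δ) (c-least (c - δ) bound))
        where
        bound : UpperBound Exceeded (c - δ)
        bound s es with <-or-≥ (c - δ) s
        ... | inj₁ c-δ<s = ⊥-elim (none (s , es , c-δ<s))
        ... | inj₂ s≤c-δ = s≤c-δ

      higherOf : ∀ t t′ → K t → K t′ → ∃ λ w → K w × h t ≤ h w × h t′ ≤ h w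
      higherOf t t′ Kt Kt′ with <-or-≥ (h t) (h t′)
      ... | inj₁ t<t′ = t′ , Kt′ , inj₁ t<t′ , ≤-refl
      ... | inj₂ t′≤t = t , Kt , ≤-refl , t′≤t

      -- Two values cover everything up to c + δ: h t′ exceeds h up to s, and h t exceeds h within δ
      -- of c. As s lies beyond c - δ, no gap remains, and h w dominates both values.
      beyond : ∀ {δ s t t′ w} →
        (∀ u → proj₁ u - c ≪ δ → 0# < h t - h u) → c - δ < s →
        (∀ u → proj₁ x ≤ proj₁ u → proj₁ u ≤ s → h u < h t′) → h t ≤ h w → h t′ ≤ h w →
        ∀ u → proj₁ x ≤ proj₁ u → proj₁ u < c + δ → h u < h w
      beyond {s = s} below-t c-δ<s below-t′ t≤w t′≤w u x≤u u<c+δ with <-or-≥ s (proj₁ u)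
      ... | inj₁ s<u = <-≤-trans (0<-⇒< (below-t u (≪-between (<-trans c-δ<s s<u) u<c+δ))) t≤w
      ... | inj₂ u≤s = <-≤-trans (below-t′ u x≤u u≤s) t′≤w

      impossible : ⊥
      impossible with higher cᴶ (x≤c , c≤z)
      ... | t , Kt , hc<ht
        with lim-pos (lim-+ (lim-const (h t)) (lim-neg (cont cᴶ))) (<⇒0<- hc<ht)
      ... | near δ 0<δ below-t with exceededNear 0<δ
      ... | s , (x≤s , s≤z , t′ , Kt′ , below-t′) , c-δ<s with higherOf t t′ Kt Kt′
      ... | w , Kw , t≤w , t′≤w with <-or-≥ (proj₁ z) (c + δ)
      -- The covered range contains all of [x , z], in particular w, so h w would exceed itself. In
      -- the other case a point m beyond c is still `Exceeded`, against the choice of c.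
      ... | inj₁ z<c+δ = <-irrefl (beyond {t = t} {t′} {w} below-t c-δ<s below-t′ t≤w t′≤w w (proj₁ Kw) (≤-<-trans (proj₂ Kw) z<c+δ))
      ... | inj₂ c+δ≤z with dense (x<x+ c 0<δ)
      ...   | m , c<m , m<c+δ = <⇒≱ c<m (c-upper m
              (≤-trans x≤c (inj₁ c<m) , ≤-trans (inj₁ m<c+δ) c+δ≤z , w , Kw ,
               λ u x≤u u≤m → beyond {t = t} {t′} {w} below-t c-δ<s below-t′ t≤w t′≤w u x≤u (≤-<-trans u≤m m<c+δ)))

    extremeValue : ∀ {h} → (∀ t → Lim h t (h t)) → ∀ {x z} → proj₁ x ≤ proj₁ z →
                   ∃ λ c → c ∈⟦ x , z ⟧ × IsMaximum h x z c
    extremeValue {h} cont {x} {z} x≤z with em {∃ λ c → c ∈⟦ x , z ⟧ × IsMaximum h x z c}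
    ... | yes found = found
    ... | no  none  = ⊥-elim (ExtremeValue.impossible cont {x} {z} x≤z none)

    -- The slope keeps the sign of L near c. If that sign is positive, h exceeds h c just to the
    -- right of c; if negative, just to the left.
    interiorMaximum⇒≈0 : ∀ {h x z c L} → proj₁ x < proj₁ c → proj₁ c < proj₁ z →
                         IsMaximum h x z c → Differentiable h c L → L ≈ 0#
    interiorMaximum⇒≈0 {h} {x} {z} {c} {L} x<c c<z max d with <.compare L 0#
    ... | tri≈ _ L≈0 _ = L≈0
    ... | tri> _ _ 0<L with lim-pos (slope→L d) 0<L
    ...   | near δ 0<δ pos with min-bound (proj₁ z) (proj₁ c + δ) c<z (x<x+ (proj₁ c) 0<δ)
    ...   | m , c<m , m≤z , m≤c+δ with dense c<m
    ...   | s , c<s , s<m = ⊥-elim (<⇒≱ hc<hs (max sᴶ (inj₁ x<s , s≤z)))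
      where
      x<s = <-trans x<c c<s
      s≤z = ≤-trans (inj₁ s<m) m≤z
      sᴶ : Point J
      sᴶ = s , convex (proj₂ x) (inj₁ x<s) s≤z (proj₂ z)
      hc<hs : h c < h sᴶ
      hc<hs = 0<-⇒< (<-respʳ (sym (secant d sᴶ))
        (*-pos (pos sᴶ (≪-between (<-trans (x-<x (proj₁ c) 0<δ) c<s) (<-≤-trans s<m m≤c+δ))) (<⇒0<- c<s)))
    interiorMaximum⇒≈0 {h} {x} {z} {c} {L} x<c c<z max d
        | tri< L<0 _ _ with lim-pos (lim-neg (slope→L d)) (neg-neg L<0)
    ...   | near δ 0<δ pos with max-bound (proj₁ x) (proj₁ c - δ) x<c (x-<x (proj₁ c) 0<δ)
    ...   | m , m<c , x≤m , c-δ≤m with dense m<c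
    ...   | s , m<s , s<c = ⊥-elim (<⇒≱ hc<hs (max sᴶ (x≤s , inj₁ s<z)))
      where
      s<z = <-trans s<c c<z
      x≤s = ≤-trans x≤m (inj₁ m<s)
      sᴶ : Point J
      sᴶ = s , convex (proj₂ x) x≤s (inj₁ s<z) (proj₂ z)
      hc<hs : h c < h sᴶ
      hc<hs = 0<-⇒< (<-respʳ
        (trans (solve 3 (λ k s c → :- k :* (c :- s) := k :* (s :- c)) refl (slope d sᴶ) s (proj₁ c)) (sym (secant d sᴶ)))
        (*-pos (pos sᴶ (≪-between (≤-<-trans c-δ≤m m<s) (<-trans s<c (x<x+ (proj₁ c) 0<δ)))) (<⇒0<- s<c)))

    -- If the maximum on [x , z] is attained at an endpoint, then y, being at least as high as both
    -- endpoints, is a maximum as well. So some interior point is a maximum, and h′ vanishes there.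
    noPeak : ∀ {h h′ : Point J → Carrier} → (∀ t → Differentiable h t (h′ t)) → (∀ t → h′ t ≉ 0#) →
             ∀ {x y z : Point J} → proj₁ x < proj₁ y → proj₁ y < proj₁ z → ¬ (h x ≤ h y × h z ≤ h y)
    noPeak {h} d h′≉0 {x} {y} {z} x<y y<z (hx≤hy , hz≤hy)
      with extremeValue (λ t → d⇒lim (d t)) {x} {z} (inj₁ (<-trans x<y y<z))
    ... | c , (x≤c , c≤z) , max = end x≤c c≤z
      where
      atY : h c ≤ h y → ⊥
      atY hc≤hy = h′≉0 y (interiorMaximum⇒≈0 {x = x} {z} x<y y<z (λ u Ku → ≤-trans (max u Ku) hc≤hy) (d y))

      cong≤ : ∀ {u v w} → proj₁ u ≈ proj₁ v → h u ≤ h w → h v ≤ h w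
      cong≤ {u} {v} u≈v = ≤-trans (inj₂ (lim⇒≈ (d⇒lim (d u)) v (sym u≈v)))

      end : proj₁ x ≤ proj₁ c → proj₁ c ≤ proj₁ z → ⊥
      end (inj₁ x<c) (inj₁ c<z) = h′≉0 c (interiorMaximum⇒≈0 {x = x} {z} x<c c<z max (d c))
      end (inj₁ _)   (inj₂ c≈z) = atY (cong≤ {z} {c} {y} (sym c≈z) hz≤hy)
      end (inj₂ x≈c) _          = atY (cong≤ {x} {c} {y} x≈c hx≤hy)

    module NonvanishingDerivative
      {h h′ : Point J → Carrier} (d : ∀ t → Differentiable h t (h′ t)) (h′≉0 : ∀ t → h′ t ≉ 0#)
      where

      noValley : ∀ {x y z : Point J} → proj₁ x < proj₁ y → proj₁ y < proj₁ z → ¬ (h y ≤ h x × h y ≤ h z)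
      noValley {x} {y} {z} x<y y<z (hy≤hx , hy≤hz) =
        noPeak {λ t → - h t} {λ t → - h′ t} (λ t → d-neg (d t)) (λ t -h′≈0 → h′≉0 t (trans (sym (-‿involutive _)) (trans (-‿cong -h′≈0) -0#≈0#)))
          {x} {y} {z} x<y y<z (neg≤ hy≤hx , neg≤ hy≤hz)
        where
        open Algebra.Properties.Ring ring using (-0#≈0#; -‿involutive)
        neg≤ : ∀ {u v} → u ≤ v → - v ≤ - u
        neg≤ (inj₁ u<v) = inj₁ (neg-anti-< u<v)
        neg≤ (inj₂ u≈v) = inj₂ (-‿cong (sym u≈v))

      -- Peaks and valleys are excluded in their weak form, so an equality between neighbouring
      -- values falls under one of the two; this gives strictness.
      monotone : ∀ (x y z : Point J) → proj₁ x < proj₁ y → proj₁ y < proj₁ z →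
                 (h x < h y × h y < h z) ⊎ (h y < h x × h z < h y)
      monotone x y z x<y y<z with <-or-≥ (h x) (h y) | <-or-≥ (h y) (h z)
      ... | inj₁ hx<hy | inj₁ hy<hz = inj₁ (hx<hy , hy<hz)
      ... | inj₁ hx<hy | inj₂ hz≤hy = ⊥-elim (noPeak d h′≉0 {x} {y} {z} x<y y<z (inj₁ hx<hy , hz≤hy))
      ... | inj₂ hy≤hx | inj₁ hy<hz = ⊥-elim (noValley {x} {y} {z} x<y y<z (hy≤hx , inj₁ hy<hz))
      ... | inj₂ (inj₁ hy<hx) | inj₂ (inj₁ hz<hy) = inj₂ (hy<hx , hz<hy)
      ... | inj₂ (inj₂ hy≈hx) | inj₂ hz≤hy        = ⊥-elim (noPeak d h′≉0 {x} {y} {z} x<y y<z (inj₂ (sym hy≈hx) , hz≤hy))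
      ... | inj₂ hy≤hx        | inj₂ (inj₂ hz≈hy) = ⊥-elim (noValley {x} {y} {z} x<y y<z (hy≤hx , inj₂ (sym hz≈hy)))

      <⇒h≉ : ∀ (x z : Point J) → proj₁ x < proj₁ z → h x ≉ h z
      <⇒h≉ x z x<z hx≈hz with dense x<z
      ... | y , x<y , y<z with monotone x (y , convex (proj₂ x) (inj₁ x<y) (inj₁ y<z) (proj₂ z)) z x<y y<z
      ...   | inj₁ (hx<hy , hy<hz) = <⇒≉ (<-trans hx<hy hy<hz) hx≈hz
      ...   | inj₂ (hy<hx , hz<hy) = >⇒≉ (<-trans hz<hy hy<hx) hx≈hz

      injective : ∀ {x z : Point J} → h x ≈ h z → proj₁ x ≈ proj₁ z
      injective {x} {z} hx≈hz with <.compare (proj₁ x) (proj₁ z)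
      ... | tri< x<z _ _ = ⊥-elim (<⇒h≉ x z x<z hx≈hz)
      ... | tri≈ _ x≈z _ = x≈z
      ... | tri> _ _ z<x = ⊥-elim (<⇒h≉ z x z<x (sym hx≈hz))

      -- By `monotone`, h y is no farther from h x than h z is, whichever way h runs.
      ≪-right : ∀ {x y z : Point J} {e} → proj₁ x < proj₁ y → proj₁ y ≤ proj₁ z → h z - h x ≪ e → h y - h x ≪ e
      ≪-right {x} {y} {z} x<y (inj₂ y≈z) p = ≪-resp (+-congʳ (lim⇒≈ (d⇒lim (d y)) z (sym y≈z))) p
      ≪-right {x} {y} {z} x<y (inj₁ y<z) p with monotone x y z x<y y<z
      ... | inj₁ (hx<hy , hy<hz) = bounds (<-trans (+-monoˡ-< _ hy<hz) (upper p))
              (<-trans (neg-pos (<⇒0<- hx<hy)) (<-trans (<⇒0<- (<-trans hx<hy hy<hz)) (upper p)))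
      ... | inj₂ (hy<hx , hz<hy) = bounds
              (<-trans (<⇒-<0 hy<hx) (<-trans (neg-neg (<⇒-<0 (<-trans hz<hy hy<hx))) (lower p)))
              (<-trans (neg-anti-< (+-monoˡ-< _ hz<hy)) (lower p))

      ≪-left : ∀ {x y z : Point J} {e} → proj₁ x ≤ proj₁ y → proj₁ y < proj₁ z → h x - h z ≪ e → h y - h z ≪ e
      ≪-left {x} {y} {z} (inj₂ x≈y) y<z p = ≪-resp (+-congʳ (lim⇒≈ (d⇒lim (d y)) x x≈y)) p
      ≪-left {x} {y} {z} (inj₁ x<y) y<z p with monotone x y z x<y y<z
      ... | inj₂ (hy<hx , hz<hy) = bounds (<-trans (+-monoˡ-< _ hy<hx) (upper p))
              (<-trans (neg-pos (<⇒0<- hz<hy)) (<-trans (<⇒0<- (<-trans hz<hy hy<hx)) (upper p)))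
      ... | inj₁ (hx<hy , hy<hz) = bounds
              (<-trans (<⇒-<0 hy<hz) (<-trans (neg-neg (<⇒-<0 (<-trans hx<hy hy<hz))) (lower p)))
              (<-trans (neg-anti-< (+-monoˡ-< _ hx<hy)) (lower p))

      -- Let u and v bracket t within δ, and let η be at most the distances of h u and h v from h t.
      -- If s were not strictly between u and v, then h u or h v would be within η of h t along with
      -- h s.
      inverseContinuous : ∀ t {δ} → 0# < δ →
        ∃ λ η → 0# < η × (∀ s → h s - h t ≪ η → proj₁ s - proj₁ t ≪ δ)
      inverseContinuous t {δ} 0<δ with pointBelow t 0<δ | pointAbove t 0<δ
      ... | u , u<t , t-δ<u | v , t<v , v<t+δ
        with ≉0⇒¬≪ (λ p → <⇒h≉ u t u<t (-≈0⇒≈ p)) | ≉0⇒¬≪ (λ p → <⇒h≉ t v t<v (sym (-≈0⇒≈ p)))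
      ... | e₁ , 0<e₁ , ¬u | e₂ , 0<e₂ , ¬v with min-bound e₁ e₂ 0<e₁ 0<e₂
      ... | η , 0<η , η≤e₁ , η≤e₂ = η , 0<η , within-δ
        where
        within-δ : ∀ s → h s - h t ≪ η → proj₁ s - proj₁ t ≪ δ
        within-δ s p with <-or-≥ (proj₁ u) (proj₁ s) | <-or-≥ (proj₁ s) (proj₁ v)
        ... | inj₁ u<s | inj₁ s<v = ≪-between (<-trans t-δ<u u<s) (<-trans s<v v<t+δ)
        ... | inj₂ s≤u | _        = ⊥-elim (¬u (≪-weaken η≤e₁ (≪-left {s} {u} {t} s≤u u<t p)))
        ... | _        | inj₂ v≤s = ⊥-elim (¬v (≪-weaken η≤e₂ (≪-right {t} {v} {s} t<v v≤s p)))

    -- The new slope is the slope of k divided by the slope of f at t. The latter has no zero: a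
    -- zero at s means f s = f t, hence s = t by injectivity, but the slope at t is f′ t.
    d-inverse : ∀ (f : Fun J) {f′ : Point J → Carrier} →
                (∀ t → Differentiable (f ⟨$⟩_) t (f′ t)) → (f′≉0 : ∀ t → f′ t ≉ 0#) →
                ∀ {k M} (p : Point (Image f)) → Differentiable k (proj₁ (proj₂ p)) M →
                Differentiable (λ q → k (proj₁ (proj₂ q))) p (M * inv (f′ (proj₁ (proj₂ p))) (f′≉0 (proj₁ (proj₂ p))))
    d-inverse f {f′} d f′≉0 {k} {M} p@(x , t , ft≈x) dk = record
      { slope   = λ q → slp (proj₁ (proj₂ q))
      ; secant  = λ { (y , s , fs≈y) → trans (secant dk s) (trans
          (trans (*-congˡ (trans (sym (*-identityˡ _)) (*-congʳ (sym (vφ≈1 s)))))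
            (solve 4 (λ ψ v φ x → ψ :* ((φ :* v) :* x) := (ψ :* v) :* (φ :* x)) refl
              (slope dk s) (v s) (slope (d t) s) (proj₁ s - proj₁ t)))
          (*-congˡ (trans (sym (secant (d t) s)) (+-cong fs≈y (-‿cong ft≈x))))) }
      ; slope→L = lim λ ε 0<ε → pull (close slp→ ε 0<ε)
      }
      where
      open NonvanishingDerivative d f′≉0
      φ≉0 : ∀ s → slope (d t) s ≉ 0#
      φ≉0 s φs≈0 = f′≉0 t (trans (sym (lim⇒≈ (slope→L (d t)) s s≈t)) φs≈0)
        where
        s≈t : proj₁ s ≈ proj₁ t
        s≈t = injective {s} {t} (-≈0⇒≈ (trans (secant (d t) s) (trans (*-congʳ φs≈0) (zeroˡ _))))

      v : Point J → Carrier
      v s = inv (slope (d t) s) (φ≉0 s)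

      vφ≈1 : ∀ s → slope (d t) s * v s ≈ 1#
      vφ≈1 s = *-invʳ _ (φ≉0 s)

      slp : Point J → Carrier
      slp s = slope dk s * v s

      slp→ : Lim slp t (M * inv (f′ t) (f′≉0 t))
      slp→ = lim-* (slope→L dk) (lim-reciprocal vφ≈1 (*-invʳ _ (f′≉0 t)) (slope→L (d t)))

      pull : ∀ {P} → Near t P → Near p (λ q → P (proj₁ (proj₂ q)))
      pull (near δ 0<δ w) with inverseContinuous t 0<δ
      ... | η , 0<η , cont = near η 0<η λ { (y , s , fs≈y) y-x≪η →
        w s (cont s (≪-resp (+-cong (sym fs≈y) (-‿cong (sym ft≈x))) y-x≪η)) }

-- The recurrence, for sums that depend only on block sizes.

module BlockPolynomials (R : CommutativeRing 0ℓ 0ℓ) where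

  open CommutativeRing R
  open IntegerSolver R
  open Relation.Binary.Reasoning.Setoid setoid

  fromℕ : ℕ → Carrier
  fromℕ zero    = 0#
  fromℕ (suc n) = 1# + fromℕ n

  -- ∑split N φ is the sum of φ ∣A∣ ∣Aᶜ∣ over the subsets A of an N-element set.

  ∑split : ℕ → (ℕ → ℕ → Carrier) → Carrier
  ∑split zero    φ = φ 0 0
  ∑split (suc N) φ = ∑split N (λ i j → φ (suc i) j) + ∑split N (λ i j → φ i (suc j))

  ∑split-cong : ∀ N {φ ψ} → (∀ i j → i ℕ.+ j ≡ N → φ i j ≈ ψ i j) → ∑split N φ ≈ ∑split N ψ
  ∑split-cong zero    φ≈ψ = φ≈ψ 0 0 ≡.refl
  ∑split-cong (suc N) φ≈ψ = +-cong
    (∑split-cong N (λ i j eq → φ≈ψ (suc i) j (≡.cong suc eq)))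
    (∑split-cong N (λ i j eq → φ≈ψ i (suc j) (≡.trans (ℕ.+-suc i j) (≡.cong suc eq))))

  ∑split-cong′ : ∀ N {φ ψ} → (∀ i j → φ i j ≈ ψ i j) → ∑split N φ ≈ ∑split N ψ
  ∑split-cong′ N φ≈ψ = ∑split-cong N (λ i j _ → φ≈ψ i j)

  ∑split-+ : ∀ N φ ψ → ∑split N (λ i j → φ i j + ψ i j) ≈ ∑split N φ + ∑split N ψ
  ∑split-+ zero    φ ψ = refl
  ∑split-+ (suc N) φ ψ = trans (+-cong (∑split-+ N _ _) (∑split-+ N _ _))
    (solve 4 (λ a b c d → (a :+ b) :+ (c :+ d) := (a :+ c) :+ (b :+ d)) refl _ _ _ _)

  ∑split-*ˡ : ∀ N c φ → ∑split N (λ i j → c * φ i j) ≈ c * ∑split N φ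
  ∑split-*ˡ zero    c φ = refl
  ∑split-*ˡ (suc N) c φ = trans (+-cong (∑split-*ˡ N c _) (∑split-*ˡ N c _)) (sym (distribˡ c _ _))

  ∑split-0 : ∀ N → ∑split N (λ _ _ → 0#) ≈ 0#
  ∑split-0 zero    = refl
  ∑split-0 (suc N) = trans (+-cong (∑split-0 N) (∑split-0 N)) (+-identityˡ 0#)

  ∑split-empty : ∀ N {φ} → (∀ i j → φ (suc i) j ≈ 0#) → ∑split N φ ≈ φ 0 N
  ∑split-empty zero    _  = refl
  ∑split-empty (suc N) φ0 = trans
    (+-cong (trans (∑split-cong′ N φ0) (∑split-0 N)) (∑split-empty N (λ i j → φ0 i (suc j))))
    (+-identityˡ _)

  -- Marking an element of the complement: choose it first.

  ∑split-mark : ∀ N (χ ψ : ℕ → ℕ → Carrier) → (∀ i → χ i 0 ≈ 0#) → (∀ i j → χ i (suc j) ≈ fromℕ (suc j) * ψ i j) →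
                ∑split (suc N) χ ≈ fromℕ (suc N) * ∑split N ψ
  ∑split-mark zero    χ ψ χ0 χs = trans (+-cong (χ0 1) (χs 0 0)) (+-identityˡ _)
  ∑split-mark (suc N) χ ψ χ0 χs = begin
    ∑split (suc N) (λ i j → χ (suc i) j) + ∑split (suc N) (λ i j → χ i (suc j))
      ≈⟨ +-cong (∑split-mark N (λ i j → χ (suc i) j) (λ i j → ψ (suc i) j) (λ i → χ0 (suc i)) (λ i → χs (suc i)))
                (trans (∑split-cong′ (suc N) (λ i j → trans (χs i j)
                         (trans (distribʳ _ _ _) (+-congʳ (*-identityˡ _)))))
                       (∑split-+ (suc N) ψ (λ i j → fromℕ j * ψ i j))) ⟩
    fromℕ (suc N) * A + ((A + B) + ∑split (suc N) (λ i j → fromℕ j * ψ i j))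
      ≈⟨ +-congˡ (+-congˡ (∑split-mark N (λ i j → fromℕ j * ψ i j) (λ i j → ψ i (suc j)) (λ i → zeroˡ _) (λ i j → refl))) ⟩
    fromℕ (suc N) * A + ((A + B) + fromℕ (suc N) * B)
      ≈⟨ solve 3 (λ n A B → n :* A :+ ((A :+ B) :+ n :* B) := (con ℤ.1ℤ :+ n) :* (A :+ B)) refl (fromℕ (suc N)) A B ⟩
    fromℕ (suc (suc N)) * (A + B) ∎
    where
    A = ∑split N (λ i j → ψ (suc i) j)
    B = ∑split N (λ i j → ψ i (suc j))

  -- Throughout, a i stands for the i-th derivative of f at a point; primed
  -- names denote the formal derivatives of the unprimed ones.

  module Blocks (a : ℕ → Carrier) where

    -- The weight of a block with suc i elements, singletons being excluded.

    block : ℕ → Carrier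
    block zero    = 0#
    block (suc i) = a (2 ℕ.+ i)

    block′ : ℕ → Carrier
    block′ zero    = 0#
    block′ (suc i) = a (3 ℕ.+ i)

    -- The weighted number of partitions of an N-element set into k blocks,
    -- by the block of the first element.

    partitions : ℕ → ℕ → Carrier
    partitions zero    zero    = 1#
    partitions zero    (suc N) = 0#
    partitions (suc k) zero    = 0#
    partitions (suc k) (suc N) = ∑split N (λ i j → block i * partitions k j)

    partitions′ : ℕ → ℕ → Carrier
    partitions′ zero    N       = 0#
    partitions′ (suc k) zero    = 0#
    partitions′ (suc k) (suc N) =
      ∑split N (λ i j → block′ i * partitions k j + block i * partitions′ k j)

    -- Each of the k blocks needs at least two elements, and the formal derivative leaves the weight
    -- of a singleton at 0.
    partitions-0 : ∀ k {N} → N ℕ.< k ℕ.+ k → partitions k N ≈ 0# × partitions′ k N ≈ 0#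
    partitions-0 (suc k) {zero}  _ = refl , refl
    partitions-0 (suc k) {suc N} (s≤s N<) = trans (∑split-cong N (λ i j eq → proj₁ (term i j eq))) (∑split-0 N) ,
                                           trans (∑split-cong N (λ i j eq → proj₂ (term i j eq))) (∑split-0 N)
      where
      term : ∀ i j → i ℕ.+ j ≡ N →
             block i * partitions k j ≈ 0# ×
             block′ i * partitions k j + block i * partitions′ k j ≈ 0#
      term zero    j eq = zeroˡ _ , trans (+-cong (zeroˡ _) (zeroˡ _)) (+-identityˡ _)
      term (suc i) j ≡.refl with partitions-0 k {j} (ℕ.≤-trans (s≤s (ℕ.m≤n+m j i)) (ℕ.≤-pred (≡.subst (suc (suc i ℕ.+ j) ℕ.≤_) (ℕ.+-suc k k) N<)))
      ... | p , q = trans (*-congˡ p) (zeroʳ _) ,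
        trans (+-cong (trans (*-congˡ p) (zeroʳ _)) (trans (*-congˡ q) (zeroʳ _))) (+-identityˡ _)

    -- Sums over the partitions of a set with a distinguished additional
    -- element: u i is the weight of its block if i other elements lie in it.

    pointed : (ℕ → Carrier) → ℕ → ℕ → Carrier
    pointed u k M = ∑split M (λ i j → u i * partitions k j)

    pointed′ : (u u′ : ℕ → Carrier) → ℕ → ℕ → Carrier
    pointed′ u u′ k M = ∑split M (λ i j → u′ i * partitions k j + u i * partitions′ k j)

    pointed′-0 : ∀ {u u′ : ℕ → Carrier} k {M} → M ℕ.< k ℕ.+ k → pointed′ u u′ k M ≈ 0#
    pointed′-0 {u} {u′} k {M} M<2k = trans (∑split-cong M term) (∑split-0 M)
      where
      term : ∀ i j → i ℕ.+ j ≡ M → u′ i * partitions k j + u i * partitions′ k j ≈ 0#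
      term i j ≡.refl with partitions-0 k (ℕ.≤-trans (s≤s (ℕ.m≤n+m j i)) M<2k)
      ... | p , q = trans (+-cong (trans (*-congˡ p) (zeroʳ _)) (trans (*-congˡ q) (zeroʳ _))) (+-identityˡ _)

    -- The partitions of a set of suc N elements in which the new element
    -- forms a pair with one of the others.

    paired : ℕ → ℕ → Carrier
    paired zero    N       = 0#
    paired (suc k) zero    = 0#
    paired (suc k) (suc N) = fromℕ (suc N) * (a 2 * partitions k N)

    -- The partner of the new element may be chosen first, among all M + 1 elements; the other M are
    -- then divided between the distinguished block and the remaining k blocks.
    ∑paired-suc : ∀ (u : ℕ → Carrier) k M → ∑split (suc M) (λ i j → u i * paired (suc k) j) ≈ fromℕ (suc M) * (a 2 * pointed u k M)
    ∑paired-suc u k M = trans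
      (∑split-mark M (λ i j → u i * paired (suc k) j) (λ i j → a 2 * (u i * partitions k j)) (λ i → zeroʳ _) (λ i j →
        solve 4 (λ u n a p → u :* (n :* (a :* p)) := n :* (a :* (u :* p))) refl (u i) (fromℕ (suc j)) (a 2) (partitions k j)))
      (*-congˡ (∑split-*ˡ M (a 2) _))

    ∑paired-zero : ∀ (u : ℕ → Carrier) M → ∑split M (λ i j → u i * paired 0 j) ≈ 0#
    ∑paired-zero u M = trans (∑split-cong′ M (λ i j → zeroʳ _)) (∑split-0 M)

    ∑paired-block : ∀ k N → ∑split N (λ i j → block i * paired k j) ≈ fromℕ N * (a 2 * partitions k N)
    ∑paired-block zero    zero    = trans (zeroʳ _) (sym (zeroˡ _))
    ∑paired-block zero    (suc N) = trans (∑paired-zero block (suc N)) (sym (trans (*-congˡ (zeroʳ _)) (zeroʳ _)))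
    ∑paired-block (suc k) zero    = trans (zeroʳ _) (sym (zeroˡ _))
    ∑paired-block (suc k) (suc N) = ∑paired-suc block k N

    -- The new element joins either the distinguished block or the rest. The recurrence for the rest
    -- is a hypothesis because the lemma also serves inside the induction that proves
    -- `partitions-suc`.
    pointed-suc′ : ∀ (u : ℕ → Carrier) k M → (∀ j → partitions k (suc j) ≈ partitions′ k j + paired k j) →
      pointed u k (suc M) ≈
      ∑split M (λ i j → u (suc i) * partitions k j + u i * partitions′ k j) + ∑split M (λ i j → u i * paired k j)
    pointed-suc′ u k M step = begin
      ∑split M (λ i j → u (suc i) * partitions k j) + ∑split M (λ i j → u i * partitions k (suc j))
        ≈⟨ ∑split-+ M _ _ ⟨
      ∑split M (λ i j → u (suc i) * partitions k j + u i * partitions k (suc j))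
        ≈⟨ ∑split-cong′ M (λ i j → trans (+-congˡ (trans (*-congˡ (step j)) (distribˡ _ _ _))) (sym (+-assoc _ _ _))) ⟩
      ∑split M (λ i j → (u (suc i) * partitions k j + u i * partitions′ k j) + u i * paired k j)
        ≈⟨ ∑split-+ M _ _ ⟩
      ∑split M (λ i j → u (suc i) * partitions k j + u i * partitions′ k j) + ∑split M (λ i j → u i * paired k j) ∎

    -- A new element joins an old block, which amounts to differentiating the
    -- weight of that block, or forms a pair with an old element. (It cannot
    -- join an old singleton, as there are none.)

    partitions-suc : ∀ k N → partitions k (suc N) ≈ partitions′ k N + paired k N
    partitions-suc zero    N       = sym (+-identityˡ _)
    partitions-suc (suc k) zero    = trans (zeroˡ _) (sym (+-identityˡ _))
    partitions-suc (suc k) (suc N) = begin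
      pointed block k (suc N)
        ≈⟨ pointed-suc′ block k N (partitions-suc k) ⟩
      ∑split N (λ i j → block (suc i) * partitions k j + block i * partitions′ k j) + ∑split N (λ i j → block i * paired k j)
        ≈⟨ +-cong (trans (∑split-cong′ N split) (∑split-+ N _ _)) (∑paired-block k N) ⟩
      (partitions′ (suc k) (suc N) + ∑split N (λ i j → fresh i * partitions k j)) + fromℕ N * (a 2 * partitions k N)
        ≈⟨ +-congʳ (+-congˡ (∑split-empty N (λ i j → zeroˡ _))) ⟩
      (partitions′ (suc k) (suc N) + a 2 * partitions k N) + fromℕ N * (a 2 * partitions k N)
        ≈⟨ solve 3 (λ p q n → (p :+ q) :+ n :* q := p :+ (con ℤ.1ℤ :+ n) :* q) refl _ (a 2 * partitions k N) (fromℕ N) ⟩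
      partitions′ (suc k) (suc N) + paired (suc k) (suc N) ∎
      where
      -- `block (suc i)` differs from `block′ i` only at i = 0, where the new element pairs with the
      -- first one. This adds the missing partner to the N counted by `∑paired-block`.
      fresh : ℕ → Carrier
      fresh zero    = a 2
      fresh (suc i) = 0#

      block-suc : ∀ i → block (suc i) ≈ block′ i + fresh i
      block-suc zero    = sym (+-identityˡ _)
      block-suc (suc i) = sym (+-identityʳ _)

      split : ∀ i j → block (suc i) * partitions k j + block i * partitions′ k j ≈
                      (block′ i * partitions k j + block i * partitions′ k j) + fresh i * partitions k j
      split i j = trans (+-congʳ (*-congʳ (block-suc i)))
        (solve 4 (λ b f p q → (b :+ f) :* p :+ q := (b :* p :+ q) :+ f :* p) refl
          (block′ i) (fresh i) (partitions k j) (block i * partitions′ k j))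

    pointed-suc-zero : ∀ (u : ℕ → Carrier) M → pointed u 0 (suc M) ≈ pointed′ u (λ i → u (suc i)) 0 M
    pointed-suc-zero u M = trans (pointed-suc′ u 0 M (partitions-suc 0))
      (trans (+-congˡ (∑paired-zero u M)) (+-identityʳ _))

    -- With n = l + 1 and M = k + l this is the recurrence for P (n+1) (k+1); suc M = n + k is the
    -- number of possible partners.
    pointed-suc-suc : ∀ (u : ℕ → Carrier) k M → pointed u (suc k) (suc (suc M)) ≈
      pointed′ u (λ i → u (suc i)) (suc k) (suc M) + fromℕ (suc M) * (a 2 * pointed u k M)
    pointed-suc-suc u k M = trans (pointed-suc′ u (suc k) (suc M) (partitions-suc (suc k)))
      (+-congˡ (∑paired-suc u k M))

  module _ {a ã : ℕ → Carrier} (a≈ã : ∀ i → a i ≈ ã i) where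

    private
      module A = Blocks a
      module Ã = Blocks ã

    block-cong : ∀ i → A.block i ≈ Ã.block i
    block-cong zero    = refl
    block-cong (suc i) = a≈ã (2 ℕ.+ i)

    partitions-cong : ∀ k N → A.partitions k N ≈ Ã.partitions k N
    partitions-cong zero    zero    = refl
    partitions-cong zero    (suc N) = refl
    partitions-cong (suc k) zero    = refl
    partitions-cong (suc k) (suc N) = ∑split-cong′ N (λ i j → *-cong (block-cong i) (partitions-cong k j))

    pointed-cong : ∀ {u ũ : ℕ → Carrier} → (∀ i → u i ≈ ũ i) → ∀ k M → A.pointed u k M ≈ Ã.pointed ũ k M
    pointed-cong u≈ũ k M = ∑split-cong′ M (λ i j → *-cong (u≈ũ i) (partitions-cong k j))

-- Families of sets that cover each element exactly once.

module Families where

  open Data.List.Membership.DecPropositional ℕ._≟_ using (_∈_; _∉_; _∈?_)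

  subsets-All : ∀ {A : Set} {P : Pred A 0ℓ} {xs} → All P xs → All (All P) (subsets xs)
  subsets-All []         = [] ∷ []
  subsets-All (px ∷ pxs) = All.++⁺ (subsets-All pxs) (All.map⁺ (All.map (px ∷_) (subsets-All pxs)))

  filter-all-map-∷ : ∀ {A : Set} {P : Pred A 0ℓ} (P? : Decidable P) {x} → P x → ∀ yss →
                     filter (all? P?) (map (x ∷_) yss) ≡ map (x ∷_) (filter (all? P?) yss)
  filter-all-map-∷ P? px []         = ≡.refl
  filter-all-map-∷ {P = P} P? {x} px (ys ∷ yss) = step (all? P? ys)
    where
    step : Dec (All P ys) → filter (all? P?) (map (x ∷_) (ys ∷ yss)) ≡ map (x ∷_) (filter (all? P?) (ys ∷ yss))
    step (yes pys) = ≡.trans (List.filter-accept (all? P?) (px ∷ pys))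
      (≡.trans (≡.cong ((x ∷ ys) ∷_) (filter-all-map-∷ P? px yss))
        (≡.cong (map (x ∷_)) (≡.sym (List.filter-accept (all? P?) pys))))
    step (no ¬pys) = ≡.trans (List.filter-reject (all? P?) (¬pys ∘ All.tail))
      (≡.trans (filter-all-map-∷ P? px yss)
        (≡.cong (map (x ∷_)) (≡.sym (List.filter-reject (all? P?) ¬pys))))

  -- Both sides list the same sublists in the same order. Applied at two levels, it turns the
  -- families whose blocks avoid A into the families on the complement of A.
  filter-all-subsets : ∀ {A : Set} {P : Pred A 0ℓ} (P? : Decidable P) xs →
                       filter (all? P?) (subsets xs) ≡ subsets (filter P? xs)
  filter-all-subsets P? []       = ≡.refl
  filter-all-subsets P? (x ∷ xs) with P? x
  ... | yes px = ≡.trans (List.filter-++ (all? P?) (subsets xs) _)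
    (≡.cong₂ _++_ (filter-all-subsets P? xs)
      (≡.trans (filter-all-map-∷ P? px (subsets xs)) (≡.cong (map (x ∷_)) (filter-all-subsets P? xs))))
  ... | no ¬px = ≡.trans (List.filter-++ (all? P?) (subsets xs) _)
    (≡.trans (≡.cong₂ _++_ (filter-all-subsets P? xs)
      (List.filter-none (all? P?) (All.map⁺ (All.universal (λ _ → ¬px ∘ All.head) (subsets xs)))))
      (List.++-identityʳ _))

  filter-cong-All : ∀ {A : Set} {P Q : Pred A 0ℓ} (P? : Decidable P) (Q? : Decidable Q) {xs} →
                    All (λ x → (P x → Q x) × (Q x → P x)) xs → filter P? xs ≡ filter Q? xs
  filter-cong-All P? Q? []                        = ≡.refl
  filter-cong-All P? Q? {x ∷ xs} ((to , from) ∷ P⇔Q) with P? x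
  ... | yes px = ≡.trans (≡.cong (x ∷_) (filter-cong-All P? Q? P⇔Q)) (≡.sym (List.filter-accept Q? (to px)))
  ... | no ¬px = ≡.trans (filter-cong-All P? Q? P⇔Q) (≡.sym (List.filter-reject Q? (¬px ∘ from)))

  infixl 6 _∖_

  _∖_ : List ℕ → List ℕ → List ℕ
  U ∖ A = filter (λ i → ¬? (i ∈? A)) U

  ∖-Unique : ∀ {U} A → Unique U → Unique (U ∖ A)
  ∖-Unique A = Unique.filter⁺ (λ i → ¬? (i ∈? A))

  All≢⇒∉ : ∀ {i A} → All (i ≢_) A → i ∉ A
  All≢⇒∉ = All.All¬⇒¬Any

  multiplicity : ℕ → List Block → ℕ
  multiplicity i π = length (filter (i ∈?_) π)

  multiplicity-++ : ∀ i π ρ → multiplicity i (π ++ ρ) ≡ multiplicity i π ℕ.+ multiplicity i ρ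
  multiplicity-++ i π ρ = ≡.trans (≡.cong length (List.filter-++ (i ∈?_) π ρ)) (List.length-++ (filter (i ∈?_) π))

  multiplicity-none : ∀ {i π} → All (i ∉_) π → multiplicity i π ≡ 0
  multiplicity-none none = ≡.cong length (List.filter-none (_ ∈?_) none)

  multiplicity-all : ∀ {i π} → All (i ∈_) π → multiplicity i π ≡ length π
  multiplicity-all every = ≡.cong length (List.filter-all (_ ∈?_) every)

  multiplicity-0 : ∀ {i π} → multiplicity i π ≡ 0 → All (i ∉_) π
  multiplicity-0 {i} m≡0 = All.¬Any⇒All¬ _ (λ some → ℕ.<⇒≢ (List.filter-some (i ∈?_) some) (≡.sym m≡0))

  ExactCover : List ℕ → Pred (List Block) 0ℓ
  ExactCover U π = All (λ i → multiplicity i π ≡ 1) U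

  exactCover? : ∀ U → Decidable (ExactCover U)
  exactCover? U π = all? (λ i → multiplicity i π ℕ.≟ 1) U

  Avoids : List ℕ → Pred (List Block) 0ℓ
  Avoids A = All (All (_∉ A))

  avoids? : ∀ A → Decidable (Avoids A)
  avoids? A = all? (all? (λ i → ¬? (i ∈? A)))

  module _ {x : ℕ} {U A : List ℕ} {π : List Block}
    (x≢U : All (x ≢_) U) (A⊆U : All (_∈ U) A) (x∉π : All (x ∉_) π) where

    private
      last : List Block
      last = (x ∷ A) ∷ []

      π⁺ : List Block
      π⁺ = π ++ last

      inLast : ∀ {i} → i ∈ x ∷ A → multiplicity i last ≡ 1
      inLast i∈ = multiplicity-all (i∈ ∷ [])

      notInLast : ∀ {i} → i ∉ x ∷ A → multiplicity i last ≡ 0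
      notInLast i∉ = multiplicity-none (i∉ ∷ [])

    -- Multiplicities add under concatenation, and the last block contributes 1 exactly on `x ∷ A`.
    -- This leaves 0 in π for the elements of A and 1 for the rest of U.
    exactCover-last⁻ : ExactCover (x ∷ U) π⁺ → Avoids A π × ExactCover (U ∖ A) π
    exactCover-last⁻ (_ ∷ cover) = All.tabulate (λ B∈π → All.tabulate (λ i∈B i∈A → disjoint i∈A B∈π i∈B)) ,
                                   All.tabulate (λ i∈U∖A → rest i∈U∖A)
      where
      disjoint : ∀ {i B} → i ∈ A → B Membership.∈ π → ¬ (i ∈ B)
      disjoint {i} i∈A B∈π i∈B = All.lookup (multiplicity-0 {i} {π} m≡0) B∈π i∈B
        where
        m≡0 : multiplicity i π ≡ 0
        m≡0 = ℕ.+-cancelʳ-≡ 1 _ 0 (≡.trans (≡.cong (multiplicity i π ℕ.+_) (≡.sym (inLast (there i∈A))))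
          (≡.trans (≡.sym (multiplicity-++ i π last)) (All.lookup cover (All.lookup A⊆U i∈A))))

      rest : ∀ {i} → i ∈ U ∖ A → multiplicity i π ≡ 1
      rest {i} i∈U∖A with ∈-filter⁻ (λ i → ¬? (i ∈? A)) i∈U∖A
      ... | i∈U , i∉A = ≡.trans (≡.sym (ℕ.+-identityʳ _)) (≡.trans
        (≡.cong (multiplicity i π ℕ.+_) (≡.sym (notInLast i∉x∷A)))
        (≡.trans (≡.sym (multiplicity-++ i π last)) (All.lookup cover i∈U)))
        where
        i∉x∷A : i ∉ x ∷ A
        i∉x∷A (here ≡.refl) = All≢⇒∉ x≢U i∈U
        i∉x∷A (there i∈A)   = i∉A i∈A

    exactCover-last⁺ : Avoids A π → ExactCover (U ∖ A) π → ExactCover (x ∷ U) π⁺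
    exactCover-last⁺ avoids cover =
      ≡.trans (multiplicity-++ x π last) (≡.cong₂ ℕ._+_ (multiplicity-none x∉π) (inLast (here ≡.refl)))
      ∷ All.tabulate once
      where
      once : ∀ {i} → i ∈ U → multiplicity i π⁺ ≡ 1
      once {i} i∈U with i ∈? A
      ... | yes i∈A = ≡.trans (multiplicity-++ i π last) (≡.cong₂ ℕ._+_
              (multiplicity-none (All.map (λ B∩A≡∅ i∈B → All.lookup B∩A≡∅ i∈B i∈A) avoids)) (inLast (there i∈A)))
      ... | no  i∉A = ≡.trans (multiplicity-++ i π last) (≡.cong₂ ℕ._+_
              (All.lookup cover (∈-filter⁺ (λ i → ¬? (i ∈? A)) i∈U i∉A)) (notInLast i∉x∷A))
        where
        i∉x∷A : i ∉ x ∷ A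
        i∉x∷A (here ≡.refl) = All≢⇒∉ x≢U i∈U
        i∉x∷A (there i∈A)   = i∉A i∈A

  exactCover⇒single : ∀ {x U} π {ρ} → All (x ∉_) π → All (x ∈_) ρ → ExactCover (x ∷ U) (π ++ ρ) → length ρ ≡ 1
  exactCover⇒single {x} π {ρ} x∉π x∈ρ (m≡1 ∷ _) = ≡.trans (≡.sym (multiplicity-all x∈ρ))
    (≡.trans (≡.cong (ℕ._+ multiplicity x ρ) (≡.sym (multiplicity-none x∉π)))
      (≡.trans (≡.sym (multiplicity-++ x π ρ)) m≡1))

-- From the sum over set partitions to sums over block sizes.

module Enumeration (ℝ : CompleteOrderedField) where

  open Calculus ℝ
  open Families
  open BlockPolynomials commutativeRing
  open IntegerSolver commutativeRing
  open Relation.Binary.Reasoning.Setoid setoid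
  open Data.List.Membership.DecPropositional ℕ._≟_ using (_∈_; _∉_; _∈?_)

  ∑-cong-All : ∀ {A : Set} {φ ψ : A → Carrier} {xs} → All (λ x → φ x ≈ ψ x) xs → ∑ φ xs ≈ ∑ ψ xs
  ∑-cong-All []           = refl
  ∑-cong-All (φ≈ψ ∷ φ≈ψs) = +-cong φ≈ψ (∑-cong-All φ≈ψs)

  ∑-cong : ∀ {A : Set} {φ ψ : A → Carrier} xs → (∀ x → φ x ≈ ψ x) → ∑ φ xs ≈ ∑ ψ xs
  ∑-cong xs φ≈ψ = ∑-cong-All (All.universal φ≈ψ xs)

  ∑-0 : ∀ {A : Set} (xs : List A) → ∑ (λ _ → 0#) xs ≈ 0#
  ∑-0 []       = refl
  ∑-0 (x ∷ xs) = trans (+-identityˡ _) (∑-0 xs)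

  ∑-++ : ∀ {A : Set} (φ : A → Carrier) xs ys → ∑ φ (xs ++ ys) ≈ ∑ φ xs + ∑ φ ys
  ∑-++ φ []       ys = sym (+-identityˡ _)
  ∑-++ φ (x ∷ xs) ys = trans (+-congˡ (∑-++ φ xs ys)) (sym (+-assoc _ _ _))

  ∑-map : ∀ {A B : Set} (φ : B → Carrier) (f : A → B) xs → ∑ φ (map f xs) ≈ ∑ (φ ∘ f) xs
  ∑-map φ f []       = refl
  ∑-map φ f (x ∷ xs) = +-congˡ (∑-map φ f xs)

  ∑-+ : ∀ {A : Set} (φ ψ : A → Carrier) xs → ∑ (λ x → φ x + ψ x) xs ≈ ∑ φ xs + ∑ ψ xs
  ∑-+ φ ψ []       = sym (+-identityˡ _)
  ∑-+ φ ψ (x ∷ xs) = trans (+-congˡ (∑-+ φ ψ xs))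
    (solve 4 (λ a b c d → (a :+ b) :+ (c :+ d) := (a :+ c) :+ (b :+ d)) refl _ _ _ _)

  ∑-*ˡ : ∀ {A : Set} c (φ : A → Carrier) xs → ∑ (λ x → c * φ x) xs ≈ c * ∑ φ xs
  ∑-*ˡ c φ []       = sym (zeroʳ c)
  ∑-*ˡ c φ (x ∷ xs) = trans (+-congˡ (∑-*ˡ c φ xs)) (sym (distribˡ c _ _))

  ∑-swap : ∀ {A B : Set} (φ : A → B → Carrier) xs ys →
           ∑ (λ x → ∑ (φ x) ys) xs ≈ ∑ (λ y → ∑ (λ x → φ x y) xs) ys
  ∑-swap φ []       ys = sym (∑-0 ys)
  ∑-swap φ (x ∷ xs) ys = trans (+-congˡ (∑-swap φ xs ys)) (sym (∑-+ (φ x) _ ys))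

  ∏-++ : ∀ {A : Set} (φ : A → Carrier) xs ys → ∏ φ (xs ++ ys) ≈ ∏ φ xs * ∏ φ ys
  ∏-++ φ []       ys = sym (*-identityˡ _)
  ∏-++ φ (x ∷ xs) ys = trans (*-congˡ (∏-++ φ xs ys)) (sym (*-assoc _ _ _))

  infixr 6 _·_

  -- An Iverson bracket: it turns sums over filtered lists into unrestricted sums, which can be
  -- split and interchanged.
  _·_ : ∀ {P : Set} → Dec P → Carrier → Carrier
  p · x = if does p then x else 0#

  ·-yes : ∀ {P : Set} (p : Dec P) {x} → P → p · x ≈ x
  ·-yes (yes _) _ = refl
  ·-yes (no ¬p) p = contradiction p ¬p

  ·-no : ∀ {P : Set} (p : Dec P) {x} → ¬ P → p · x ≈ 0#
  ·-no (yes p) ¬p = contradiction p ¬p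
  ·-no (no _)  _  = refl

  ·-cong : ∀ {P Q : Set} (p : Dec P) (q : Dec Q) {x y} → (P → Q) → (Q → P) → (P → x ≈ y) → p · x ≈ q · y
  ·-cong (yes p) q P⇒Q Q⇒P x≈y = trans (x≈y p) (sym (·-yes q (P⇒Q p)))
  ·-cong (no ¬p) q P⇒Q Q⇒P x≈y = sym (·-no q (¬p ∘ Q⇒P))

  ·-congʳ : ∀ {P : Set} (p : Dec P) {x y} → x ≈ y → p · x ≈ p · y
  ·-congʳ p x≈y = ·-cong p p id id (λ _ → x≈y)

  ·-× : ∀ {P Q : Set} (p : Dec P) (q : Dec Q) {x} → (p ×-dec q) · x ≈ p · q · x
  ·-× (yes _) (yes _) = refl
  ·-× (yes _) (no  _) = refl
  ·-× (no  _) _       = refl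

  ·-implied : ∀ {P Q : Set} (p : Dec P) (q : Dec Q) {x} → (P → Q) → p · x ≈ q · p · x
  ·-implied (yes p) q P⇒Q = sym (·-yes q (P⇒Q p))
  ·-implied (no ¬p) (yes _) _ = refl
  ·-implied (no ¬p) (no  _) _ = refl

  ·-* : ∀ {P : Set} (p : Dec P) c x → p · (c * x) ≈ c * (p · x)
  ·-* (yes _) c x = refl
  ·-* (no  _) c x = sym (zeroʳ c)

  ∑-filter : ∀ {A : Set} {P : Pred A 0ℓ} (P? : Decidable P) φ xs → ∑ φ (filter P? xs) ≈ ∑ (λ x → P? x · φ x) xs
  ∑-filter P? φ []       = refl
  ∑-filter P? φ (x ∷ xs) with P? x
  ... | yes _ = +-congˡ (∑-filter P? φ xs)
  ... | no  _ = trans (∑-filter P? φ xs) (sym (+-identityˡ _))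

  ∑-subsets-++ : ∀ {A : Set} (φ : List A → Carrier) xs ys →
                 ∑ φ (subsets (xs ++ ys)) ≈ ∑ (λ p → ∑ (λ q → φ (p ++ q)) (subsets ys)) (subsets xs)
  ∑-subsets-++ φ []       ys = sym (+-identityʳ _)
  ∑-subsets-++ φ (x ∷ xs) ys = begin
    ∑ φ (subsets (xs ++ ys) ++ map (x ∷_) (subsets (xs ++ ys)))
      ≈⟨ trans (∑-++ φ (subsets (xs ++ ys)) _) (+-congˡ (∑-map φ (x ∷_) (subsets (xs ++ ys)))) ⟩
    ∑ φ (subsets (xs ++ ys)) + ∑ (φ ∘ (x ∷_)) (subsets (xs ++ ys))
      ≈⟨ +-cong (∑-subsets-++ φ xs ys) (∑-subsets-++ (φ ∘ (x ∷_)) xs ys) ⟩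
    ∑ Φ (subsets xs) + ∑ (Φ ∘ (x ∷_)) (subsets xs)
      ≈⟨ trans (∑-++ Φ (subsets xs) _) (+-congˡ (∑-map Φ (x ∷_) (subsets xs))) ⟨
    ∑ Φ (subsets xs ++ map (x ∷_) (subsets xs)) ∎
    where Φ = λ p → ∑ (λ q → φ (p ++ q)) (subsets ys)

  ∑-subsets-empty : ∀ {A : Set} (φ : List A → Carrier) xs →
                    ∑ (λ q → (length q ℕ.≟ 0) · φ q) (subsets xs) ≈ φ []
  ∑-subsets-empty φ []       = +-identityʳ _
  ∑-subsets-empty φ (x ∷ xs) = begin
    ∑ Φ (subsets xs ++ map (x ∷_) (subsets xs))    ≈⟨ ∑-++ Φ (subsets xs) _ ⟩
    ∑ Φ (subsets xs) + ∑ Φ (map (x ∷_) (subsets xs)) ≈⟨ +-cong (∑-subsets-empty φ xs) (trans (∑-map Φ (x ∷_) (subsets xs)) (∑-0 (subsets xs))) ⟩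
    φ [] + 0#                                      ≈⟨ +-identityʳ _ ⟩
    φ []                                           ∎
    where Φ = λ q → (length q ℕ.≟ 0) · φ q

  ∑-subsets-single : ∀ {A : Set} (φ : List A → Carrier) xs →
                     ∑ (λ q → (length q ℕ.≟ 1) · φ q) (subsets xs) ≈ ∑ (λ x → φ (x ∷ [])) xs
  ∑-subsets-single φ []       = +-identityʳ _
  ∑-subsets-single φ (x ∷ xs) = begin
    ∑ Φ (subsets xs ++ map (x ∷_) (subsets xs))    ≈⟨ ∑-++ Φ (subsets xs) _ ⟩
    ∑ Φ (subsets xs) + ∑ Φ (map (x ∷_) (subsets xs)) ≈⟨ +-cong (∑-subsets-single φ xs)
      (trans (∑-map Φ (x ∷_) (subsets xs)) (trans (∑-cong (subsets xs) (λ q →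
        ·-cong (suc (length q) ℕ.≟ 1) (length q ℕ.≟ 0) ℕ.suc-injective (≡.cong suc) (λ _ → refl)))
        (∑-subsets-empty (φ ∘ (x ∷_)) xs))) ⟩
    ∑ (λ x → φ (x ∷ [])) xs + φ (x ∷ [])           ≈⟨ +-comm _ _ ⟩
    φ (x ∷ []) + ∑ (λ x → φ (x ∷ [])) xs           ∎
    where Φ = λ q → (length q ℕ.≟ 1) · φ q

  -- `subsets` lists the sets containing x after all others, so a family on `x ∷ U` is a family π
  -- without x followed by a family ρ of sets containing x. Covering x once forces ρ to be a single
  -- block `x ∷ A`, and π then covers what A leaves of U.
  ∑-exactCover-∷ : ∀ {x U} → All (x ≢_) U → (φ : List Block → Carrier) →
    ∑ (λ π → exactCover? (x ∷ U) π · φ π) (subsets (subsets (x ∷ U))) ≈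
    ∑ (λ A → ∑ (λ π → exactCover? (U ∖ A) π · φ (π ++ (x ∷ A) ∷ [])) (subsets (subsets (U ∖ A)))) (subsets U)
  ∑-exactCover-∷ {x} {U} x≢U φ = begin
    ∑ Φ (subsets (subsets U ++ map (x ∷_) (subsets U)))
      ≈⟨ ∑-subsets-++ Φ (subsets U) _ ⟩
    ∑ (λ π → ∑ (λ ρ → Φ (π ++ ρ)) (subsets (map (x ∷_) (subsets U)))) (subsets (subsets U))
      ≈⟨ ∑-cong-All (All.map (λ x∉π → ∑-cong-All (All.map (λ x∈ρ → onlyOne _ x∉π x∈ρ) ρ-facts)) π-facts) ⟩
    ∑ (λ π → ∑ (λ ρ → (length ρ ℕ.≟ 1) · Φ (π ++ ρ)) (subsets (map (x ∷_) (subsets U)))) (subsets (subsets U))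
      ≈⟨ ∑-cong (subsets (subsets U)) (λ π → trans
           (∑-subsets-single (λ ρ → Φ (π ++ ρ)) (map (x ∷_) (subsets U)))
           (∑-map (λ B → Φ (π ++ B ∷ [])) (x ∷_) (subsets U))) ⟩
    ∑ (λ π → ∑ (λ A → Φ (π ++ (x ∷ A) ∷ [])) (subsets U)) (subsets (subsets U))
      ≈⟨ ∑-swap (λ π A → Φ (π ++ (x ∷ A) ∷ [])) (subsets (subsets U)) (subsets U) ⟩
    ∑ (λ A → ∑ (λ π → Φ (π ++ (x ∷ A) ∷ [])) (subsets (subsets U))) (subsets U)
      ≈⟨ ∑-cong-All (All.map (λ {A} A⊆U → restrict A A⊆U) (subsets-All (All.tabulate id))) ⟩
    ∑ (λ A → ∑ (λ π → exactCover? (U ∖ A) π · φ (π ++ (x ∷ A) ∷ [])) (subsets (subsets (U ∖ A)))) (subsets U) ∎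
    where
    Φ : List Block → Carrier
    Φ π = exactCover? (x ∷ U) π · φ π

    π-facts : All (All (x ∉_)) (subsets (subsets U))
    π-facts = subsets-All (All.map All≢⇒∉ (subsets-All x≢U))

    ρ-facts : All (All (x ∈_)) (subsets (map (x ∷_) (subsets U)))
    ρ-facts = subsets-All (All.map⁺ (All.universal (λ _ → here ≡.refl) (subsets U)))

    onlyOne : ∀ π {ρ} → All (x ∉_) π → All (x ∈_) ρ → Φ (π ++ ρ) ≈ (length ρ ℕ.≟ 1) · Φ (π ++ ρ)
    onlyOne π {ρ} x∉π x∈ρ = ·-implied (exactCover? (x ∷ U) (π ++ ρ)) (length ρ ℕ.≟ 1)
      (exactCover⇒single π x∉π x∈ρ)

    restrict : ∀ A → All (_∈ U) A →
      ∑ (λ π → Φ (π ++ (x ∷ A) ∷ [])) (subsets (subsets U)) ≈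
      ∑ (λ π → exactCover? (U ∖ A) π · φ (π ++ (x ∷ A) ∷ [])) (subsets (subsets (U ∖ A)))
    restrict A A⊆U = begin
      ∑ (λ π → Φ (π ++ (x ∷ A) ∷ [])) (subsets (subsets U))
        ≈⟨ ∑-cong-All (All.map (λ {π} x∉π → trans
             (·-cong (exactCover? (x ∷ U) (π ++ (x ∷ A) ∷ [])) (avoids? A π ×-dec exactCover? (U ∖ A) π)
               (exactCover-last⁻ x≢U A⊆U x∉π)
               (λ { (avoids , cover) → exactCover-last⁺ x≢U A⊆U x∉π avoids cover })
               (λ _ → refl))
             (·-× (avoids? A π) (exactCover? (U ∖ A) π))) π-facts) ⟩
      ∑ (λ π → avoids? A π · Ψ π) (subsets (subsets U))
        ≈⟨ ∑-filter (avoids? A) Ψ (subsets (subsets U)) ⟨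
      ∑ Ψ (filter (avoids? A) (subsets (subsets U)))
        ≡⟨ ≡.cong (∑ Ψ) (≡.trans (filter-all-subsets _ (subsets U)) (≡.cong subsets (filter-all-subsets _ U))) ⟩
      ∑ Ψ (subsets (subsets (U ∖ A))) ∎
      where
      Ψ : List Block → Carrier
      Ψ π = exactCover? (U ∖ A) π · φ (π ++ (x ∷ A) ∷ [])

  ∑-subsets-split : ∀ {U} → Unique U → (ψ : ℕ → ℕ → Carrier) →
    ∑ (λ A → ψ (length A) (length (U ∖ A))) (subsets U) ≈ ∑split (length U) ψ
  ∑-subsets-split {[]}    []              ψ = +-identityʳ _
  ∑-subsets-split {x ∷ U} (x≢U ∷ unique) ψ = begin
    ∑ Φ (subsets U ++ map (x ∷_) (subsets U))
      ≈⟨ trans (∑-++ Φ (subsets U) _) (+-congˡ (∑-map Φ (x ∷_) (subsets U))) ⟩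
    ∑ Φ (subsets U) + ∑ (Φ ∘ (x ∷_)) (subsets U)
      ≈⟨ +-comm _ _ ⟩
    ∑ (Φ ∘ (x ∷_)) (subsets U) + ∑ Φ (subsets U)
      ≈⟨ +-cong
           (trans (∑-cong (subsets U) (λ A → reflexive (≡.cong (λ V → ψ (suc (length A)) (length V)) (within A))))
                  (∑-subsets-split unique (λ i j → ψ (suc i) j)))
           (trans (∑-cong-All (All.map (λ {A} x∉A → reflexive (≡.cong (λ V → ψ (length A) (length V))
                    (List.filter-accept (λ i → ¬? (i ∈? A)) (All≢⇒∉ x∉A)))) (subsets-All x≢U)))
                  (∑-subsets-split unique (λ i j → ψ i (suc j)))) ⟩
    ∑split (suc (length U)) ψ ∎
    where
    Φ : List ℕ → Carrier
    Φ A = ψ (length A) (length ((x ∷ U) ∖ A))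

    within : ∀ A → (x ∷ U) ∖ (x ∷ A) ≡ U ∖ A
    within A = ≡.trans (List.filter-reject (λ i → ¬? (i ∈? x ∷ A)) (λ x∉x∷A → x∉x∷A (here ≡.refl)))
      (filter-cong-All _ _ (All.map (λ x≢i → (λ i∉ i∈A → i∉ (there i∈A)) ,
        (λ { i∉A (here i≡x) → x≢i (≡.sym i≡x) ; i∉A (there i∈A) → i∉A i∈A })) x≢U))

  Admissible : ℕ → Pred (List Block) 0ℓ
  Admissible k π = length π ≡ k × All (λ B → 2 ℕ.≤ length B) π

  admissible? : ∀ k → Decidable (Admissible k)
  admissible? k π = (length π ℕ.≟ k) ×-dec all? (λ B → 2 ℕ.≤? length B) π

  length-∷ʳ : ∀ (π : List Block) B → length (π ++ B ∷ []) ≡ suc (length π)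
  length-∷ʳ π B = ≡.trans (List.length-++ π) (ℕ.+-comm (length π) 1)

  module _ (a : ℕ → Carrier) where

    open Blocks a

    ∏a : List Block → Carrier
    ∏a = ∏ (a ∘ length)

    ∑-partitions : ∀ k {U} → Unique U →
      ∑ (λ π → exactCover? U π · admissible? k π · ∏a π) (subsets (subsets U)) ≈ partitions k (length U)
    ∑-partitions k {U} unique = go k (length U) ℕ.≤-refl unique
      where
      go : ∀ k n {U} → length U ℕ.≤ n → Unique U →
           ∑ (λ π → exactCover? U π · admissible? k π · ∏a π) (subsets (subsets U)) ≈ partitions k (length U)
      -- The empty set carries two families: the empty one, and the one consisting of the empty
      -- block. Only the first is admissible, and only for k = 0.
      go zero    _ {[]} _ _ = trans (+-congˡ (+-identityˡ _)) (+-identityʳ _)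
      go (suc k) _ {[]} _ _ = trans (+-identityˡ _) (trans (+-congʳ (·-no (admissible? (suc k) ([] ∷ [])) (λ { (_ , () ∷ _) }))) (+-identityʳ _))
      go zero (suc n) {x ∷ U} _ (x≢U ∷ _) = trans (∑-exactCover-∷ x≢U _) (trans
        (∑-cong (subsets U) (λ A → trans (∑-cong (subsets (subsets (U ∖ A))) (λ π → trans
            (·-congʳ (exactCover? (U ∖ A) π) (·-no (admissible? 0 (π ++ (x ∷ A) ∷ [])) (nonempty π)))
            (·-0 (exactCover? (U ∖ A) π))))
          (∑-0 (subsets (subsets (U ∖ A))))))
        (∑-0 (subsets U)))
        where
        nonempty : ∀ π {B} → ¬ Admissible 0 (π ++ B ∷ [])
        nonempty π {B} (l≡0 , _) with ≡.trans (≡.sym (length-∷ʳ π B)) l≡0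
        ... | ()
        ·-0 : ∀ {P : Set} (p : Dec P) → p · 0# ≈ 0#
        ·-0 (yes _) = refl
        ·-0 (no  _) = refl
      go (suc k) (suc n) {x ∷ U} (s≤s l≤n) (x≢U ∷ unique) = trans (∑-exactCover-∷ x≢U _) (trans
        (∑-cong (subsets U) (λ A → trans
          (∑-cong (subsets (subsets (U ∖ A))) (λ π → trans
            (·-congʳ (exactCover? (U ∖ A) π) (last A π))
            (·-* (exactCover? (U ∖ A) π) (block (length A)) _)))
          (trans (∑-*ˡ (block (length A)) _ (subsets (subsets (U ∖ A))))
            (*-congˡ (go k n (ℕ.≤-trans (List.length-filter (λ i → ¬? (i ∈? A)) U) l≤n) (∖-Unique A unique))))))
        (∑-subsets-split unique (λ i j → block i * partitions k j)))
        where
        last : ∀ A π → admissible? (suc k) (π ++ (x ∷ A) ∷ []) · ∏a (π ++ (x ∷ A) ∷ []) ≈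
                       block (length A) * (admissible? k π · ∏a π)
        last [] π = trans (·-no (admissible? (suc k) (π ++ (x ∷ []) ∷ [])) singleton) (sym (zeroˡ _))
          where
          singleton : ¬ Admissible (suc k) (π ++ (x ∷ []) ∷ [])
          singleton (_ , large) with All.++⁻ʳ π large
          ... | s≤s () ∷ _
        last A@(_ ∷ A′) π = trans
          (·-cong (admissible? (suc k) (π ++ (x ∷ A) ∷ [])) (admissible? k π)
            (λ { (l≡ , large) → ℕ.suc-injective (≡.trans (≡.sym (length-∷ʳ π (x ∷ A))) l≡) , All.++⁻ˡ π large })
            (λ { (l≡ , large) → ≡.trans (length-∷ʳ π (x ∷ A)) (≡.cong suc l≡) , All.++⁺ large (s≤s (s≤s z≤n) ∷ []) })
            (λ _ → trans (∏-++ _ π _) (trans (*-congˡ (*-identityʳ _)) (*-comm _ _))))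
          (·-* (admissible? k π) _ _)

    -- Here b i stands for the i-th derivative of g.

    ∑-Π : ∀ (b : ℕ → Carrier) l k →
      ∑ (λ π → b (length (B₁ π)) * ∏a (otherBlocks π)) (Π (suc l) k) ≈ pointed (b ∘ suc) k (k ℕ.+ l)
    ∑-Π b l k = begin
      ∑ w (Π (suc l) k)
        ≈⟨ ∑-filter (InΠ? (suc l) k) w (subsets (subsets [1‥ k ℕ.+ suc l ])) ⟩
      ∑ (λ π → InΠ? (suc l) k π · w π) (subsets (subsets [1‥ k ℕ.+ suc l ]))
        ≈⟨ ∑-cong (subsets (subsets [1‥ k ℕ.+ suc l ])) (λ π → trans
             (·-cong (InΠ? (suc l) k π) (exactCover? [1‥ k ℕ.+ suc l ] π ×-dec shape? π)
               (λ { ((ne , cover) , l≡ , large) → cover , ne , l≡ , large })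
               (λ { (cover , ne , l≡ , large) → (ne , cover) , l≡ , large })
               (λ _ → refl))
             (·-× (exactCover? [1‥ k ℕ.+ suc l ] π) (shape? π))) ⟩
      ∑ (λ π → exactCover? [1‥ k ℕ.+ suc l ] π · shape? π · w π) (subsets (subsets [1‥ k ℕ.+ suc l ]))
        ≡⟨ ≡.cong (λ m → ∑ (λ π → exactCover? [1‥ m ] π · shape? π · w π) (subsets (subsets [1‥ m ]))) (ℕ.+-suc k l) ⟩
      ∑ (λ π → exactCover? (1 ∷ U) π · shape? π · w π) (subsets (subsets (1 ∷ U)))
        -- As 1 heads the list, the block split off is the one that may be a singleton. The size
        -- condition on all the others becomes unconditional, as in `admissible?`.
        ≈⟨ ∑-exactCover-∷ 1≢U _ ⟩
      ∑ (λ A → ∑ (λ π → exactCover? (U ∖ A) π · shape? (π ++ (1 ∷ A) ∷ []) · w (π ++ (1 ∷ A) ∷ [])) (subsets (subsets (U ∖ A)))) (subsets U)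
        ≈⟨ ∑-cong (subsets U) (λ A → trans
             (∑-cong-All (All.map (λ {π} 1∉π → trans
               (·-congʳ (exactCover? (U ∖ A) π) (last A π 1∉π))
               (·-* (exactCover? (U ∖ A) π) (b (suc (length A))) _))
               (subsets-All (All.map All≢⇒∉ (subsets-All (All.filter⁺ (λ i → ¬? (i ∈? A)) 1≢U))))))
             (trans (∑-*ˡ (b (suc (length A))) _ (subsets (subsets (U ∖ A))))
               (*-congˡ (∑-partitions k (∖-Unique A unique))))) ⟩
      ∑ (λ A → b (suc (length A)) * partitions k (length (U ∖ A))) (subsets U)
        ≈⟨ ∑-subsets-split unique (λ i j → b (suc i) * partitions k j) ⟩
      pointed (b ∘ suc) k (length U)
        ≡⟨ ≡.cong (pointed (b ∘ suc) k) (List.length-applyUpTo (suc ∘ suc) (k ℕ.+ l)) ⟩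
      pointed (b ∘ suc) k (k ℕ.+ l) ∎
      where
      U : List ℕ
      U = applyUpTo (suc ∘ suc) (k ℕ.+ l)

      w : List Block → Carrier
      w π = b (length (B₁ π)) * ∏a (otherBlocks π)

      1≢U : All (1 ≢_) U
      1≢U = All.applyUpTo⁺₂ (suc ∘ suc) (k ℕ.+ l) (λ _ ())

      unique : Unique U
      unique = Unique.applyUpTo⁺₁ (suc ∘ suc) (k ℕ.+ l) (λ i<j _ eq → ℕ.<⇒≢ i<j (ℕ.suc-injective (ℕ.suc-injective eq)))

      Shape : Pred (List Block) 0ℓ
      Shape π = All (λ B → 1 ℕ.≤ length B) π × length π ≡ suc k × All (λ B → ¬ (1 ∈ B) → 2 ℕ.≤ length B) π

      shape? : Decidable Shape
      shape? π = all? (λ B → 1 ℕ.≤? length B) π ×-dec (length π ℕ.≟ suc k) ×-dec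
                 all? (λ B → ¬? (1 ∈? B) →-dec (2 ℕ.≤? length B)) π

      last : ∀ A π → All (1 ∉_) π →
        shape? (π ++ (1 ∷ A) ∷ []) · w (π ++ (1 ∷ A) ∷ []) ≈ b (suc (length A)) * (admissible? k π · ∏a π)
      last A π 1∉π = trans
        (·-cong (shape? (π ++ (1 ∷ A) ∷ [])) (admissible? k π)
          (λ { (_ , l≡ , large) → ℕ.suc-injective (≡.trans (≡.sym (length-∷ʳ π (1 ∷ A))) l≡) ,
               All.zipWith (λ { (1∉B , 2≤B) → 2≤B 1∉B }) (1∉π , All.++⁻ˡ π large) })
          (λ { (l≡ , large) → All.++⁺ (All.map (ℕ.≤-trans (s≤s z≤n)) large) (s≤s z≤n ∷ []) ,
               ≡.trans (length-∷ʳ π (1 ∷ A)) (≡.cong suc l≡) ,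
               All.++⁺ (All.map (λ 2≤B _ → 2≤B) large) ((λ 1∉1∷A → contradiction (here ≡.refl) 1∉1∷A) ∷ []) })
          (λ _ → *-cong (reflexive (≡.cong (b ∘ length) first)) (reflexive (≡.cong ∏a others))))
        (·-* (admissible? k π) _ _)
        where
        first : B₁ (π ++ (1 ∷ A) ∷ []) ≡ 1 ∷ A
        first = ≡.trans (≡.cong concat (≡.trans (List.filter-++ (1 ∈?_) π _) (≡.cong₂ _++_
          (List.filter-none (1 ∈?_) 1∉π) (List.filter-all (1 ∈?_) {(1 ∷ A) ∷ []} (here ≡.refl ∷ [])))))
          (List.++-identityʳ (1 ∷ A))

        others : otherBlocks (π ++ (1 ∷ A) ∷ []) ≡ π
        others = ≡.trans (List.filter-++ (λ B → ¬? (1 ∈? B)) π _) (≡.trans (≡.cong₂ _++_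
          (List.filter-all (λ B → ¬? (1 ∈? B)) 1∉π)
          (List.filter-none (λ B → ¬? (1 ∈? B)) {(1 ∷ A) ∷ []} ((λ 1∉1∷A → 1∉1∷A (here ≡.refl)) ∷ [])))
          (List.++-identityʳ π))

-- Induction on the order of the derivative.

module ParametricDerivatives (em : ExcludedMiddle 0ℓ) (ℝ : CompleteOrderedField) where

  open Calculus ℝ
  open OrderedField ℝ using (inverse-unique)
  open Differentiation ℝ
  open InverseFunction em ℝ
  open IntegerSolver commutativeRing
  open BlockPolynomials commutativeRing
  open Enumeration ℝ using (∑-Π)
  open Algebra.Properties.Semiring.Exp semiring using (^-congˡ)

  d-∑split : ∀ {S} N {φ : Point S → ℕ → ℕ → Carrier} {φ′ : ℕ → ℕ → Carrier} {t} →
             (∀ i j → i ℕ.+ j ≡ N → Differentiable (λ x → φ x i j) t (φ′ i j)) →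
             Differentiable (λ x → ∑split N (φ x)) t (∑split N φ′)
  d-∑split zero    d = d 0 0 ≡.refl
  d-∑split (suc N) d = d-+
    (d-∑split N (λ i j eq → d (suc i) j (≡.cong suc eq)))
    (d-∑split N (λ i j eq → d i (suc j) (≡.trans (ℕ.+-suc i j) (≡.cong suc eq))))

  d-sum : ∀ {S} m {φ : ℕ → Point S → Carrier} {φ′ : ℕ → Carrier} {t} →
          (∀ k → Differentiable (φ k) t (φ′ k)) →
          Differentiable (λ x → ∑[ k < m ] φ (toℕ k) x) t (∑[ k < m ] φ′ (toℕ k))
  d-sum zero    d = d-const 0#
  d-sum (suc m) d = d-+ (d 0) (d-sum m (λ k → d (suc k)))

  d-zero : ∀ {S} {h : Point S → Carrier} {t L} → (∀ x → h x ≈ 0#) → L ≈ 0# → Differentiable h t L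
  d-zero h≈0 L≈0 = d-cong (λ x → sym (h≈0 x)) (sym L≈0) (d-const 0#)

  sum-cong : ∀ m (φ ψ : ℕ → Carrier) → (∀ k → φ k ≈ ψ k) → ∑[ k < m ] φ (toℕ k) ≈ ∑[ k < m ] ψ (toℕ k)
  sum-cong zero    φ ψ φ≈ψ = refl
  sum-cong (suc m) φ ψ φ≈ψ = +-cong (φ≈ψ 0) (sum-cong m (φ ∘ suc) (ψ ∘ suc) (φ≈ψ ∘ suc))

  -- α collects the derivatives of the partition sums, which keep their index; β collects the
  -- derivatives of the powers of 1/f′, which move from index k to k + 1.
  sum-shift : ∀ m (α β : ℕ → Carrier) →
    α 0 + (∑[ k < m ] (α (suc (toℕ k)) + β (toℕ k))) ≈ (∑[ k < m ] (α (toℕ k) + β (toℕ k))) + α m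
  sum-shift zero    α β = +-comm _ _
  sum-shift (suc m) α β = begin
    α 0 + ((α 1 + β 0) + S)  ≈⟨ solve 4 (λ a b c d → a :+ ((b :+ c) :+ d) := (a :+ c) :+ (b :+ d)) refl (α 0) (α 1) (β 0) S ⟩
    (α 0 + β 0) + (α 1 + S)  ≈⟨ +-congˡ (sum-shift m (α ∘ suc) (β ∘ suc)) ⟩
    (α 0 + β 0) + (S′ + α (suc m)) ≈⟨ +-assoc _ _ _ ⟨
    ((α 0 + β 0) + S′) + α (suc m) ∎
    where
    open Relation.Binary.Reasoning.Setoid setoid
    S  = ∑[ k < m ] (α (suc (suc (toℕ k))) + β (suc (toℕ k)))
    S′ = ∑[ k < m ] (α (suc (toℕ k)) + β (suc (toℕ k)))

  sum-*ʳ : ∀ m (φ : ℕ → Carrier) c → (∑[ k < m ] φ (toℕ k)) * c ≈ ∑[ k < m ] (φ (toℕ k) * c)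
  sum-*ʳ zero    φ c = zeroˡ c
  sum-*ʳ (suc m) φ c = trans (distribʳ c _ _) (+-congˡ (sum-*ʳ m (φ ∘ suc) c))

  module Given
    {n : ℕ} {a b : Carrier ±} {f g : Fun (OpenInterval a b)}
    (F : Derivatives n f) (G : Derivatives n g)
    (f′≉0 : ∀ t → F ⁽ 1 ⁾ ⟨$⟩ t ≉ 0#)
    where

    J : Subset
    J = OpenInterval a b

    fᵗ gᵗ : Point J → ℕ → Carrier
    fᵗ t i = F ⁽ i ⁾ ⟨$⟩ t
    gᵗ t i = G ⁽ i ⁾ ⟨$⟩ t

    v : Point J → Carrier
    v t = inv (fᵗ t 1) (f′≉0 t)

    fv≈1 : ∀ t → fᵗ t 1 * v t ≈ 1#
    fv≈1 t = *-invʳ _ (f′≉0 t)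

    d-f : ∀ {i} → i ℕ.< n → ∀ t → Differentiable (λ x → fᵗ x i) t (fᵗ t (suc i))
    d-f {i} i<n t = fromHasDerivative (F ⁽ i ⁾) (Derivatives.deriv-suc F i<n t)

    d-g : ∀ {i} → i ℕ.< n → ∀ t → Differentiable (λ x → gᵗ x i) t (gᵗ t (suc i))
    d-g {i} i<n t = fromHasDerivative (G ⁽ i ⁾) (Derivatives.deriv-suc G i<n t)

    partitionsᵗ partitionsᵗ′ : Point J → ℕ → ℕ → Carrier
    partitionsᵗ  t = Blocks.partitions (fᵗ t)
    partitionsᵗ′ t = Blocks.partitions′ (fᵗ t)

    -- A product with a factor partitions k j where j < 2k vanishes identically,
    -- as does its formal derivative; in the remaining ones the orders of
    -- differentiation are small enough.

    d-product : ∀ {u : Point J → Carrier} {u′ t} k j →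
      (k ℕ.+ k ℕ.≤ j → Differentiable u t u′ × Differentiable (λ x → partitionsᵗ x k j) t (partitionsᵗ′ t k j)) →
      Differentiable (λ x → u x * partitionsᵗ x k j) t (u′ * partitionsᵗ t k j + u t * partitionsᵗ′ t k j)
    d-product {u} {u′} {t} k j d with ℕ.<-≤-connex j (k ℕ.+ k)
    ... | inj₂ 2k≤j = let du , dp = d 2k≤j in d-* du dp
    ... | inj₁ j<2k = d-zero
            (λ x → trans (*-congˡ (proj₁ (Blocks.partitions-0 (fᵗ x) k j<2k))) (zeroʳ _))
            (trans (+-cong (trans (*-congˡ (proj₁ (Blocks.partitions-0 (fᵗ t) k j<2k))) (zeroʳ _))
                           (trans (*-congˡ (proj₂ (Blocks.partitions-0 (fᵗ t) k j<2k))) (zeroʳ _)))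
                   (+-identityˡ _))

    module _ {m : ℕ} (m<n : m ℕ.< n) where

      -- If k blocks of size at least two partition N elements, none has more than N - 2(k - 1)
      -- elements. The hypothesis bounds this by m, so only derivatives of order at most m < n get
      -- differentiated.
      d-partitions : ∀ k N → 2 ℕ.+ N ℕ.≤ m ℕ.+ (k ℕ.+ k) → ∀ t →
                     Differentiable (λ x → partitionsᵗ x k N) t (partitionsᵗ′ t k N)
      d-partitions zero    zero    _ t = d-const 1#
      d-partitions zero    (suc N) _ t = d-const 0#
      d-partitions (suc k) zero    _ t = d-const 0#
      d-partitions (suc k) (suc N) 3+N≤ t = d-∑split N term
        where
        1+N≤ : 1 ℕ.+ N ℕ.≤ m ℕ.+ (k ℕ.+ k)
        1+N≤ = ℕ.≤-pred (ℕ.≤-pred (≡.subst (3 ℕ.+ N ℕ.≤_)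
          (≡.trans (≡.cong (λ l → m ℕ.+ suc l) (ℕ.+-suc k k))
            (≡.trans (ℕ.+-suc m _) (≡.cong suc (ℕ.+-suc m _)))) 3+N≤))

        term : ∀ i j → i ℕ.+ j ≡ N → Differentiable
          (λ x → Blocks.block (fᵗ x) i * partitionsᵗ x k j) t
          (Blocks.block′ (fᵗ t) i * partitionsᵗ t k j + Blocks.block (fᵗ t) i * partitionsᵗ′ t k j)
        term zero    j eq     = d-zero (λ x → zeroˡ _) (trans (+-cong (zeroˡ _) (zeroˡ _)) (+-identityˡ _))
        term (suc i) j ≡.refl = d-product k j (λ 2k≤j →
          d-f (ℕ.≤-<-trans (ℕ.+-cancelʳ-≤ j (2 ℕ.+ i) m (ℕ.≤-trans 1+N≤ (ℕ.+-monoʳ-≤ m 2k≤j))) m<n) t ,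
          d-partitions k j (ℕ.≤-trans (s≤s (s≤s (ℕ.m≤n+m j i))) 1+N≤) t)

    -- By ∑-Π, the value of this at t and k is P (suc l) k F G t.

    pointedᵗ pointedᵗ′ : ℕ → Point J → ℕ → Carrier
    pointedᵗ  l t k = Blocks.pointed (fᵗ t) (gᵗ t ∘ suc) k (k ℕ.+ l)
    pointedᵗ′ l t k = Blocks.pointed′ (fᵗ t) (gᵗ t ∘ suc) (gᵗ t ∘ suc ∘ suc) k (k ℕ.+ l)

    -- In a nonvanishing summand at least 2k of the k + l elements lie outside the block of 1. At
    -- most l others remain for that block, so the derivative of g to be differentiated has order at
    -- most l + 1 < n.
    d-pointed : ∀ {l} → suc l ℕ.< n → ∀ k t → Differentiable (λ x → pointedᵗ l x k) t (pointedᵗ′ l t k)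
    d-pointed {l} 1+l<n k t = d-∑split (k ℕ.+ l) (λ i j eq → d-product k j (λ 2k≤j →
        d-g (ℕ.≤-<-trans (s≤s (i≤l i j eq 2k≤j)) 1+l<n) t , d-parts k j (≡.subst (j ℕ.≤_) eq (ℕ.m≤n+m j i))))
      where
      i≤l : ∀ i j → i ℕ.+ j ≡ k ℕ.+ l → k ℕ.+ k ℕ.≤ j → i ℕ.≤ l
      i≤l i j eq 2k≤j = ℕ.+-cancelʳ-≤ k i l (ℕ.≤-trans (ℕ.+-monoʳ-≤ i (ℕ.≤-trans (ℕ.m≤m+n k k) 2k≤j))
        (ℕ.≤-reflexive (≡.trans eq (ℕ.+-comm k l))))

      d-parts : ∀ k j → j ℕ.≤ k ℕ.+ l → Differentiable (λ x → partitionsᵗ x k j) t (partitionsᵗ′ t k j)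
      d-parts zero    zero    _ = d-const 1#
      d-parts zero    (suc j) _ = d-const 0#
      d-parts (suc k) j j≤ = d-partitions 1+l<n (suc k) j (begin
        2 ℕ.+ j                          ≤⟨ s≤s (s≤s j≤) ⟩
        2 ℕ.+ (suc k ℕ.+ l)              ≡⟨ ≡.cong (2 ℕ.+_) (ℕ.+-comm (suc k) l) ⟩
        2 ℕ.+ (l ℕ.+ suc k)              ≡⟨ ≡.cong suc (ℕ.+-suc l (suc k)) ⟨
        suc l ℕ.+ (1 ℕ.+ suc k)          ≤⟨ ℕ.+-monoʳ-≤ (suc l) (ℕ.+-monoˡ-≤ (suc k) (s≤s z≤n)) ⟩
        suc l ℕ.+ (suc k ℕ.+ suc k)      ∎) t
        where open ℕ.≤-Reasoning

    d-v : 1 ℕ.< n → ∀ t → Differentiable v t (- (fᵗ t 2 * (v t * v t)))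
    d-v 1<n t = d-reciprocal fv≈1 (d-f 1<n t)

    d-v^ : 1 ℕ.< n → ∀ p t → Differentiable (λ x → v x ^ p) t (- (fromℕ p * (fᵗ t 2 * v t ^ suc p)))
    d-v^ 1<n zero    t = d-cong (λ _ → refl)
      (solve 1 (λ x → con ℤ.0ℤ := :- (con ℤ.0ℤ :* x)) refl _) (d-const 1#)
    d-v^ 1<n (suc p) t = d-cong (λ _ → refl)
      (solve 4 (λ c v w n → :- (c :* (v :* v)) :* w :+ v :* :- (n :* (c :* (v :* w)))
                            := :- ((con ℤ.1ℤ :+ n) :* (c :* (v :* (v :* w))))) refl (fᵗ t 2) (v t) (v t ^ p) (fromℕ p))
      (d-* (d-v 1<n t) (d-v^ 1<n p t))

    sign : ℕ → Carrier
    sign k = (- 1#) ^ k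

    term term′ : ℕ → Point J → ℕ → Carrier
    term  l t k = sign k * v t ^ (suc l ℕ.+ k) * pointedᵗ l t k
    term′ l t k = sign k * - (fromℕ (suc l ℕ.+ k) * (fᵗ t 2 * v t ^ suc (suc l ℕ.+ k))) * pointedᵗ l t k
                  + sign k * v t ^ (suc l ℕ.+ k) * pointedᵗ′ l t k

    d-term : ∀ {l} → suc l ℕ.< n → ∀ k t → Differentiable (λ x → term l x k) t (term′ l t k)
    d-term {l} 1+l<n k t = d-* (d-cong (λ _ → refl) (trans (+-congʳ (zeroˡ _)) (+-identityˡ _))
      (d-* (d-const (sign k)) (d-v^ (ℕ.≤-<-trans (s≤s z≤n) 1+l<n) (suc l ℕ.+ k) t))) (d-pointed 1+l<n k t)

    total : ℕ → Point J → Carrier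
    total l t = ∑[ k < suc l ] term l t (toℕ k)

    total-suc : ∀ l t → (∑[ k < suc l ] term′ l t (toℕ k)) * v t ≈ total (suc l) t
    total-suc l t = begin
      (∑[ k < suc l ] term′ l t (toℕ k)) * v t            ≈⟨ sum-*ʳ (suc l) (term′ l t) (v t) ⟩
      ∑[ k < suc l ] (term′ l t (toℕ k) * v t)            ≈⟨ sum-cong (suc l) _ (λ k → α k + β k) term′≈ ⟩
      ∑[ k < suc l ] (α (toℕ k) + β (toℕ k))              ≈⟨ +-identityʳ _ ⟨
      (∑[ k < suc l ] (α (toℕ k) + β (toℕ k))) + 0#       ≈⟨ +-congˡ (sym α-last) ⟩
      (∑[ k < suc l ] (α (toℕ k) + β (toℕ k))) + α (suc l) ≈⟨ sum-shift (suc l) α β ⟨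
      α 0 + (∑[ k < suc l ] (α (suc (toℕ k)) + β (toℕ k))) ≈⟨ +-cong term-0 (sum-cong (suc l) (term (suc l) t ∘ suc) (λ k → α (suc k) + β k) term-suc) ⟨
      total (suc l) t                                     ∎
      where
      open Relation.Binary.Reasoning.Setoid setoid

      α β : ℕ → Carrier
      α k = sign k * v t ^ (suc (suc l) ℕ.+ k) * pointedᵗ′ l t k
      β k = sign (suc k) * v t ^ suc (suc (suc l ℕ.+ k)) * (fromℕ (suc l ℕ.+ k) * (fᵗ t 2 * pointedᵗ l t k))

      term′≈ : ∀ k → term′ l t k * v t ≈ α k + β k
      term′≈ k = solve 7 (λ s n c v w p p′ →
          (s :* :- (n :* (c :* (v :* w))) :* p :+ s :* w :* p′) :* v
          := s :* (v :* w) :* p′ :+ (:- con ℤ.1ℤ :* s) :* (v :* (v :* w)) :* (n :* (c :* p)))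
        refl (sign k) (fromℕ (suc l ℕ.+ k)) (fᵗ t 2) (v t) (v t ^ (suc l ℕ.+ k)) (pointedᵗ l t k) (pointedᵗ′ l t k)

      -- At k = l + 1 there are 2l + 1 elements besides 1, one too few for l + 1 blocks of size two.
      α-last : α (suc l) ≈ 0#
      α-last = trans (*-congˡ (Blocks.pointed′-0 (fᵗ t) {gᵗ t ∘ suc} {gᵗ t ∘ suc ∘ suc} (suc l) {suc l ℕ.+ l}
                       (ℕ.≤-reflexive (≡.cong suc (≡.sym (ℕ.+-suc l l))))))
                     (zeroʳ _)

      term-0 : term (suc l) t 0 ≈ α 0
      term-0 = *-congˡ (Blocks.pointed-suc-zero (fᵗ t) (gᵗ t ∘ suc) l)

      term-suc : ∀ k → term (suc l) t (suc k) ≈ α (suc k) + β k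
      term-suc k = trans
        (*-congˡ (trans
          (reflexive (≡.cong (Blocks.pointed (fᵗ t) (gᵗ t ∘ suc) (suc k)) (≡.cong suc (ℕ.+-suc k l))))
          (Blocks.pointed-suc-suc (fᵗ t) (gᵗ t ∘ suc) k (k ℕ.+ l))))
        (trans (distribˡ _ _ _) (+-congˡ (*-cong
          (*-congˡ (reflexive (≡.cong (v t ^_) (≡.cong (suc ∘ suc) (ℕ.+-suc l k)))))
          (*-congʳ (reflexive (≡.cong (fromℕ ∘ suc) (ℕ.+-comm k l)))))))

    total-cong : ∀ l {t u} → proj₁ t ≈ proj₁ u → total l t ≈ total l u
    total-cong l {t} {u} t≈u = sum-cong (suc l) (term l t) (term l u) (λ k → *-cong
      (*-congˡ (^-congˡ (suc l ℕ.+ k) (inverse-unique (Func.cong (F ⁽ 1 ⁾) {t} {u} t≈u) (fv≈1 t) (fv≈1 u))))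
      (pointed-cong (λ i → Func.cong (F ⁽ i ⁾) {t} {u} t≈u) (λ i → Func.cong (G ⁽ suc i ⁾) {t} {u} t≈u) k (k ℕ.+ l)))

    derivative : ℕ → Fun J
    derivative zero    = g
    derivative (suc l) = record { to = total l ; cong = λ {t} {u} → total-cong l {t} {u} }

    -- Set partitions enter only here; all differentiation has taken place on the sums over block
    -- sizes.
    total≈ : ∀ l t → total l t ≈
      ∑[ k < suc l ] ((- 1#) ^ toℕ k * inv (F ⁽ 1 ⁾ ⟨$⟩ t) (f′≉0 t) ^ (suc l +ℕ toℕ k) * P (suc l) (toℕ k) F G t)
    total≈ l t = sum-cong (suc l) (term l t) (λ k → sign k * v t ^ (suc l ℕ.+ k) * P (suc l) k F G t)
      (λ k → *-congˡ (sym (∑-Π (fᵗ t) (gᵗ t) l k)))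

    module _ (0<n : 0 ℕ.< n) where

      d-f₀ : ∀ t → Differentiable (f ⟨$⟩_) t (fᵗ t 1)
      d-f₀ t = d-cong (Derivatives.deriv-zero F) refl (d-f 0<n t)

      f-injective : IsInjective f
      f-injective {t} {u} = NonvanishingDerivative.injective d-f₀ f′≉0 {t} {u}

      derivatives : Derivatives n (g ∘ f ⁻¹[ f-injective ])
      derivatives = record
        { deriv      = λ m → derivative m ∘ f ⁻¹[ f-injective ]
        ; deriv-zero = λ _ → refl
        ; deriv-suc  = λ {m} m<n p → toHasDerivative (derivative m ∘ f ⁻¹[ f-injective ]) (step m m<n p)
        }
        where
        step : ∀ m → m ℕ.< n → ∀ p → Differentiable
          ((derivative m ∘ f ⁻¹[ f-injective ]) ⟨$⟩_) p ((derivative (suc m) ∘ f ⁻¹[ f-injective ]) ⟨$⟩ p)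
        step zero    0<n p@(_ , t , _) = d-cong (λ _ → refl)
          -- The right side is `total 0` unfolded: its only term has k = 0, exponent 1 and the
          -- single partition of {1}, of weight g′.
          (solve 2 (λ x v → x :* v := con ℤ.1ℤ :* (v :* con ℤ.1ℤ) :* (x :* con ℤ.1ℤ) :+ con ℤ.0ℤ) refl (gᵗ t 1) (v t))
          (d-inverse f d-f₀ f′≉0 p (d-cong (Derivatives.deriv-zero G) refl (d-g 0<n t)))
        step (suc l) l<n p@(_ , t , _) = d-cong (λ _ → refl) (total-suc l t)
          (d-inverse f d-f₀ f′≉0 p (d-sum (suc l) (λ k → d-term l<n k t)))

theorem1 : ExcludedMiddle 0ℓ →
    (ℝ : CompleteOrderedField) → let open Calculus ℝ in
    (n : ℕ) → 1 ≤ℕ n →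
    (a b : Carrier ±) → let J = OpenInterval a b in
    (f g : Fun J) (F : Derivatives n f) (G : Derivatives n g) →
    (f′≉0 : ∀ t → F ⁽ 1 ⁾ ⟨$⟩ t ≉ 0#) →
    Σ[ inj ∈ IsInjective f ]
    Σ[ Y ∈ Derivatives n (g ∘ f ⁻¹[ inj ]) ]
    (∀ t → Y ⁽ n ⁾ ⟨$⟩ image f t ≈
    ∑[ k < n ] ((- 1#) ^ toℕ k
    * inv (F ⁽ 1 ⁾ ⟨$⟩ t) (f′≉0 t) ^ (n +ℕ toℕ k)
    * P n (toℕ k) F G t))
theorem1 em ℝ (suc l) 1≤n a b f g F G f′≉0 = f-injective 1≤n , derivatives 1≤n , total≈ l
  where open ParametricDerivatives.Given em ℝ F G f′≉0
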